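{- For all integers $n\geq 3$ and $k\geq 0$, $$nI_{n,k}=(k+1)I_{n-1,k}+(n-k)I_{n-1,k-1}+[(k+1)^2+n-2]I_{n-2,k}+[2k(n-k-1)-n+3]I_{n-2,k-1}+[(n-k)^2+n-2]I_{n-2,k-2},$$ where $I_{m,j}=0$ for $j<0$.
   Context: For a permutation $\pi=a_1a_2\cdots a_m$ of $[m]=\{1,\ldots,m\}$, a descent is an index $1\leq i\leq m-1$ with $a_i>a_{i+1}$, and ${\rm d}(\pi)$ is the number of descents. An involution of $[m]$ is a permutation $\pi$ with $\pi^2=\mathrm{id}$. $I_{m,j}$ denotes the number of involutions of $[m]$ with exactly $j$ descents (so $I_{m,j}=0$ for $j<0$ or $j>m-1$). -}

module Defs where

open import Algebra.Definitions using (Involutive)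
open import Data.Fin.Base using (Fin; suc; inject₁; finToFun; _>_)
open import Data.Fin.Properties using (_≟_; _<?_; all?; any?)
open import Data.Integer.Base using (ℤ; +_)
import Data.Integer.Properties as ℤ
open import Data.List.Base using (List; allFin; filter; length; map)
open import Data.Nat.Base using (ℕ; zero; suc; _^_)
open import Data.Product.Base using (_×_)
open import Function.Definitions using (Bijective)
open import Relation.Binary.PropositionalEquality.Core using (_≡_; refl)
open import Relation.Nullary.Decidable using (Dec; map′; _×-dec_; _→-dec_)

-- Fin m, with values 0, …, m - 1, plays the role of [m] = {1, …, m}.
-- A word a₁ ⋯ aₘ is the function sending the i-th position to aᵢ.

Word : ℕ → Set
Word m = Fin m → Fin m

IsPermutation : ∀ {m} → Word m → Set
IsPermutation = Bijective _≡_ _≡_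

IsInvolution : ∀ {m} → Word m → Set
IsInvolution π = IsPermutation π × Involutive _≡_ π

-- For a word of length suc m, the consecutive positions are the pairs
-- (inject₁ i , suc i) with i : Fin m.
IsDescent : ∀ {m} → Word (suc m) → Fin m → Set
IsDescent π i = π (inject₁ i) > π (suc i)

isDescent? : ∀ {m} (π : Word (suc m)) (i : Fin m) → Dec (IsDescent π i)
isDescent? π i = π (suc i) <? π (inject₁ i)

d : ∀ {m} → Word m → ℕ
d {zero}  π = 0
d {suc m} π = length (filter (isDescent? π) (allFin m))

isPermutation? : ∀ {m} (π : Word m) → Dec (IsPermutation π)
isPermutation? π =
  map′ (λ inj {i} {j} → inj i j) (λ inj i j → inj {i} {j})
       (all? λ i → all? λ j → (π i ≟ π j) →-dec (i ≟ j))
  ×-dec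
  (all? λ j → any? λ i →
    map′ (λ { πi≡j refl → πi≡j }) (λ h → h refl) (π i ≟ j))

isInvolution? : ∀ {m} (π : Word m) → Dec (IsInvolution π)
isInvolution? π = isPermutation? π ×-dec all? (λ i → π (π i) ≟ i)

-- finToFun is a bijection, up to pointwise equality, from Fin (m ^ m) onto
-- Word m, so every word is listed exactly once.
words : ∀ m → List (Word m)
words m = map finToFun (allFin (m ^ m))

-- The descent count ranges over ℤ, so that I m j is 0 for negative j.
I : ℕ → ℤ → ℤ
I m j = + length (filter (λ π → isInvolution? π ×-dec (+ d π ℤ.≟ j)) (words m))

{-# OPTIONS --safe #-}

-- Put weakly increasing letters w in Fin r on the positions of an involution π, strictly
-- increasing at its descents, and let c n r be the number of these pairs (π , w) of length n.
-- The matrix with entries A i j = #{m : w m = i, w (π m) = j} is symmetric, and every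
-- symmetric r × r matrix over ℕ with total n arises exactly once: listing the units of A in
-- lexicographic order, π exchanges the units of the cells (i , j) and (j , i) in order. So
-- the generating function of c n r in u is (1 - u)^-r (1 - u²)^-(r(r - 1)/2), and its
-- logarithmic derivative gives
--     (n + 2) c (n + 2) r = r c (n + 1) r + (r² + n) c n r.
-- On the other hand Σₛ c n (s + 1) tˢ = Σₖ I n k tᵏ / (1 - t)ⁿ⁺¹. Hence applying the
-- difference operator ∇ (multiplication by 1 - t) n + 3 times, and commuting it past the
-- multiplication by r = s + 1, turns the recurrence for c into the one for I.

module Submission where

open import Defs
open import Algebra.Definitions using (Involutive)
open import Data.Empty using (⊥-elim)
open import Data.List.Base as List using (List; []; _∷_; _++_; length; concatMap; filter; allFin)
open import Data.List.Membership.Propositional using (_∈_)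
open import Data.List.Membership.Propositional.Properties
open import Data.List.Properties using (length-map; length-++)
open import Data.List.Relation.Unary.All as All using ([])
open import Data.List.Relation.Unary.AllPairs using ([]; _∷_)
open import Data.List.Relation.Unary.Any as Any using (here; there)
open import Data.List.Relation.Unary.Any.Properties using (lookup-index)
open import Data.List.Relation.Unary.Unique.Propositional using (Unique)
open import Data.List.Relation.Unary.Unique.Propositional.Properties as Unique
  using (Unique[x∷xs]⇒x∉xs)
open import Data.Product.Base using (_×_; _,_; proj₁; proj₂; ∃; Σ-syntax; map₁)
open import Data.Product.Properties using (,-injectiveʳ)
open import Data.Sum.Base using (_⊎_; inj₁; inj₂)
open import Data.Unit.Base using (⊤; tt)
open import Data.Vec.Base as Vec using (Vec; []; _∷_; lookup; tabulate)
open import Data.Vec.Properties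
  using (lookup∘tabulate; tabulate∘lookup; tabulate-cong; ∷-injectiveʳ)
open import Function.Base using (_∘_; _on_)
open import Function.Definitions using (Injective)
open import Level using (0ℓ)
open import Relation.Binary.Definitions using (Transitive; tri<; tri≈; tri>)
open import Relation.Binary.PropositionalEquality
open import Relation.Nullary.Decidable using (does; yes; no; _×-dec_; dec-true; dec-false)
open import Relation.Nullary.Negation using (¬_)
open import Relation.Unary using (Decidable)

-- Backward differences of integer sequences.

module Differences where

  open import Data.Integer.Base using (ℤ; +_; _+_; _-_; _*_; _^_)
  open import Data.Integer.Tactic.RingSolver using (solve-∀)
  open import Data.Nat.Base using (ℕ; zero; suc)

  Seq : Set
  Seq = ℕ → ℤ

  infixl 6 _⊕_
  infixl 7 _⊙_

  _⊕_ : Seq → Seq → Seq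
  (f ⊕ g) k = f k + g k

  _⊙_ : ℤ → Seq → Seq
  (c ⊙ f) k = c * f k

  shift : Seq → Seq
  shift f zero    = + 0
  shift f (suc k) = f k

  ∇ : Seq → Seq
  ∇ f k = f k - shift f k

  -- In terms of generating functions in t, ∇ is multiplication by 1 - t and mul
  -- is d/dt ∘ t.
  mul : Seq → Seq
  mul f k = (+ k + + 1) * f k

  ∇^ : ℕ → Seq → Seq
  ∇^ zero    f = f
  ∇^ (suc m) f = ∇ (∇^ m f)

  shift-cong : ∀ {f g} → f ≗ g → shift f ≗ shift g
  shift-cong f≗g zero    = refl
  shift-cong f≗g (suc k) = f≗g k

  ∇-cong : ∀ {f g} → f ≗ g → ∇ f ≗ ∇ g
  ∇-cong f≗g k = cong₂ _-_ (f≗g k) (shift-cong f≗g k)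

  ∇^-cong : ∀ m {f g} → f ≗ g → ∇^ m f ≗ ∇^ m g
  ∇^-cong zero    f≗g = f≗g
  ∇^-cong (suc m) f≗g = ∇-cong (∇^-cong m f≗g)

  ∇^-∇ : ∀ m f → ∇^ m (∇ f) ≗ ∇ (∇^ m f)
  ∇^-∇ zero    f k = refl
  ∇^-∇ (suc m) f   = ∇-cong (∇^-∇ m f)

  ∇-⊕ : ∀ f g → ∇ (f ⊕ g) ≗ ∇ f ⊕ ∇ g
  ∇-⊕ f g zero    = lem (f zero) (g zero)
    where
    lem : ∀ a b → a + b - + 0 ≡ (a - + 0) + (b - + 0)
    lem = solve-∀
  ∇-⊕ f g (suc k) = lem (f (suc k)) (g (suc k)) (f k) (g k)
    where
    lem : ∀ a b c d → a + b - (c + d) ≡ (a - c) + (b - d)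
    lem = solve-∀

  ∇^-⊕ : ∀ m f g → ∇^ m (f ⊕ g) ≗ ∇^ m f ⊕ ∇^ m g
  ∇^-⊕ zero    f g k = refl
  ∇^-⊕ (suc m) f g k = trans (∇-cong (∇^-⊕ m f g) k) (∇-⊕ (∇^ m f) (∇^ m g) k)

  ∇-⊙ : ∀ c f → ∇ (c ⊙ f) ≗ c ⊙ ∇ f
  ∇-⊙ c f zero    = lem c (f zero)
    where
    lem : ∀ c a → c * a - + 0 ≡ c * (a - + 0)
    lem = solve-∀
  ∇-⊙ c f (suc k) = lem c (f (suc k)) (f k)
    where
    lem : ∀ c a b → c * a - c * b ≡ c * (a - b)
    lem = solve-∀

  ∇^-⊙ : ∀ m c f → ∇^ m (c ⊙ f) ≗ c ⊙ ∇^ m f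
  ∇^-⊙ zero    c f k = refl
  ∇^-⊙ (suc m) c f k = trans (∇-cong (∇^-⊙ m c f) k) (∇-⊙ c (∇^ m f) k)

  ∇^-zero : ∀ m → ∇^ m (λ _ → + 0) ≗ λ _ → + 0
  ∇^-zero zero    k       = refl
  ∇^-zero (suc m) k = trans (∇-cong (∇^-zero m) k) (∇0 k)
    where
    ∇0 : ∇ (λ _ → + 0) ≗ λ _ → + 0
    ∇0 zero    = refl
    ∇0 (suc k) = refl

  ∇-shift : ∀ f → ∇ (shift f) ≗ shift (∇ f)
  ∇-shift f zero          = refl
  ∇-shift f (suc zero)    = refl
  ∇-shift f (suc (suc k)) = refl

  ∇^-shift : ∀ m f → ∇^ m (shift f) ≗ shift (∇^ m f)
  ∇^-shift zero    f k = refl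
  ∇^-shift (suc m) f k = trans (∇-cong (∇^-shift m f) k) (∇-shift (∇^ m f) k)

  -- The product rule: the derivative of (1 - t) · t F is (1 - t) times that of t F, minus t F.
  ∇-mul : ∀ f → ∇ (mul f) ≗ mul (∇ f) ⊕ shift f
  ∇-mul f zero    = lem (f zero)
    where
    lem : ∀ a → (+ 0 + + 1) * a - + 0 ≡ (+ 0 + + 1) * (a - + 0) + + 0
    lem = solve-∀
  ∇-mul f (suc k) = lem (+ k) (f (suc k)) (f k)
    where
    lem : ∀ x a b → ((+ 1 + x) + + 1) * a - (x + + 1) * b
                  ≡ ((+ 1 + x) + + 1) * (a - b) + b
    lem = solve-∀

  -- The product rule iterated: differentiating (1 - t)^(m + 1) leaves the extra term (m + 1) t (1 -
  -- t)^m F.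
  ∇^-mul : ∀ m f → ∇^ (suc m) (mul f) ≗ mul (∇^ (suc m) f) ⊕ (+ suc m ⊙ shift (∇^ m f))
  ∇^-mul zero    f k = trans (∇-mul f k) (lem (mul (∇ f) k) (shift f k))
    where
    lem : ∀ a b → a + b ≡ a + + 1 * b
    lem = solve-∀
  ∇^-mul (suc m) f k = begin
    ∇ (∇^ (suc m) (mul f)) k
      ≡⟨ ∇-cong (∇^-mul m f) k ⟩
    ∇ (mul g ⊕ (+ suc m ⊙ shift h)) k
      ≡⟨ ∇-⊕ (mul g) (+ suc m ⊙ shift h) k ⟩
    ∇ (mul g) k + ∇ (+ suc m ⊙ shift h) k
      ≡⟨ cong₂ _+_ (∇-mul g k)
           (trans (∇-⊙ (+ suc m) (shift h) k) (cong (+ suc m *_) (∇-shift h k))) ⟩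
    mul (∇ g) k + shift g k + + suc m * shift g k
      ≡⟨ lem (+ suc m) (mul (∇ g) k) (shift g k) ⟩
    mul (∇ g) k + + suc (suc m) * shift g k ∎
    where
    open ≡-Reasoning
    g = ∇^ (suc m) f
    h = ∇^ m f
    lem : ∀ c a b → a + b + c * b ≡ a + (+ 1 + c) * b
    lem = solve-∀

  module _ (F G H : Seq) (f g h : Seq) (n : ℕ)
    (f-∇ : ∇^ (suc (suc (suc n))) F ≗ f)
    (g-∇ : ∇^ (suc (suc n)) G ≗ g)
    (h-∇ : ∇^ (suc n) H ≗ h)
    (rec : + suc (suc n) ⊙ F ≗ mul G ⊕ (mul (mul H) ⊕ (+ n ⊙ H)))
    where

    private
      -- This is `mul H` after n + 2 differences, expressed through `h`; the outer `mul` then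
      -- absorbs one more difference.
      u : Seq
      u = mul (∇ h) ⊕ (+ suc (suc n) ⊙ shift h)

      ∇^u : ∇^ (suc (suc n)) (mul H) ≗ u
      ∇^u k = trans (∇^-mul (suc n) H k)
        (cong₂ _+_ (cong ((+ k + + 1) *_) (∇-cong h-∇ k))
                   (cong (+ suc (suc n) *_) (shift-cong h-∇ k)))

    -- The order n + 3 is the one that turns F into f. It exceeds the orders belonging to g and h by
    -- one and two, so differences of g and second differences of h remain.
    ∇-rec : + suc (suc n) ⊙ f ≗
      (mul (∇ g) ⊕ (+ suc (suc (suc n)) ⊙ shift g)) ⊕
      ((mul (∇ u) ⊕ (+ suc (suc (suc n)) ⊙ shift u)) ⊕ (+ n ⊙ ∇ (∇ h)))
    ∇-rec k = begin
      + suc (suc n) * f k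
        ≡⟨ cong (+ suc (suc n) *_) (f-∇ k) ⟨
      + suc (suc n) * ∇^ N F k
        ≡⟨ ∇^-⊙ N (+ suc (suc n)) F k ⟨
      ∇^ N (+ suc (suc n) ⊙ F) k
        ≡⟨ ∇^-cong N rec k ⟩
      ∇^ N (mul G ⊕ (mul (mul H) ⊕ (+ n ⊙ H))) k
        ≡⟨ trans (∇^-⊕ N _ _ k) (cong (λ x → ∇^ N (mul G) k + x) (∇^-⊕ N _ _ k)) ⟩
      ∇^ N (mul G) k + (∇^ N (mul (mul H)) k + ∇^ N (+ n ⊙ H) k)
        ≡⟨ cong₂ _+_
             (trans (∇^-mul (suc (suc n)) G k)
               (cong₂ _+_ (cong ((+ k + + 1) *_) (∇-cong g-∇ k))
                          (cong (+ N *_) (shift-cong g-∇ k))))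
             (cong₂ _+_
               (trans (∇^-mul (suc (suc n)) (mul H) k)
                 (cong₂ _+_ (cong ((+ k + + 1) *_) (∇-cong ∇^u k))
                            (cong (+ N *_) (shift-cong ∇^u k))))
               (trans (∇^-⊙ N (+ n) H k)
                 (cong (+ n *_) (∇-cong (∇-cong h-∇) k)))) ⟩
      _ ∎
      where
      open ≡-Reasoning
      N = suc (suc (suc n))

    -- Expand `∇-rec` and collect the values of g and h at k, k - 1 and k - 2. The indices 0 and 1
    -- are separate because some of these values are then the 0 supplied by `shift`.
    coefficients-rec : ∀ k → + suc (suc n) * f k ≡
        (+ k + + 1) * g k
      + (+ suc (suc n) - + k) * shift g k
      + ((+ k + + 1) ^ 2 + + suc (suc n) - + 2) * h k
      + (+ 2 * + k * (+ suc (suc n) - + k - + 1) - + suc (suc n) + + 3) * shift h k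
      + ((+ suc (suc n) - + k) ^ 2 + + suc (suc n) - + 2) * shift (shift h) k
    coefficients-rec zero = trans (∇-rec zero) (lem (+ n) (g 0) (h 0))
      where
      -- Squares appear as x * (x * 1), the form to which x ^ 2 computes.
      lem : ∀ n a b →
        ((+ 0 + + 1) * (a - + 0) + (+ 3 + n) * + 0)
        + (((+ 0 + + 1) * (((+ 0 + + 1) * (b - + 0) + (+ 2 + n) * + 0) - + 0) + (+ 3 + n) * + 0)
          + n * ((b - + 0) - + 0))
        ≡ (+ 0 + + 1) * a + (+ 2 + n - + 0) * + 0
        + ((+ 0 + + 1) * ((+ 0 + + 1) * + 1) + (+ 2 + n) - + 2) * b
        + (+ 2 * + 0 * (+ 2 + n - + 0 - + 1) - (+ 2 + n) + + 3) * + 0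
        + ((+ 2 + n - + 0) * ((+ 2 + n - + 0) * + 1) + (+ 2 + n) - + 2) * + 0
      lem = solve-∀
    coefficients-rec (suc zero) = trans (∇-rec 1) (lem (+ n) (g 1) (g 0) (h 1) (h 0))
      where
      lem : ∀ n a a′ b b′ →
        ((+ 1 + + 1) * (a - a′) + (+ 3 + n) * a′)
        + (((+ 1 + + 1) * (((+ 1 + + 1) * (b - b′) + (+ 2 + n) * b′)
              - ((+ 0 + + 1) * (b′ - + 0) + (+ 2 + n) * + 0))
            + (+ 3 + n) * ((+ 0 + + 1) * (b′ - + 0) + (+ 2 + n) * + 0))
          + n * ((b - b′) - (b′ - + 0)))
        ≡ (+ 1 + + 1) * a + (+ 2 + n - + 1) * a′
        + ((+ 1 + + 1) * ((+ 1 + + 1) * + 1) + (+ 2 + n) - + 2) * b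
        + (+ 2 * + 1 * (+ 2 + n - + 1 - + 1) - (+ 2 + n) + + 3) * b′
        + ((+ 2 + n - + 1) * ((+ 2 + n - + 1) * + 1) + (+ 2 + n) - + 2) * + 0
      lem = solve-∀
    coefficients-rec (suc (suc k)) = trans (∇-rec (suc (suc k)))
      (lem (+ n) (+ k) (g (suc (suc k))) (g (suc k)) (h (suc (suc k))) (h (suc k)) (h k))
      where
      lem : ∀ n k a a′ b b′ b″ →
        (((+ 2 + k) + + 1) * (a - a′) + (+ 3 + n) * a′)
        + ((((+ 2 + k) + + 1) * ((((+ 2 + k) + + 1) * (b - b′) + (+ 2 + n) * b′)
              - (((+ 1 + k) + + 1) * (b′ - b″) + (+ 2 + n) * b″))
            + (+ 3 + n) * (((+ 1 + k) + + 1) * (b′ - b″) + (+ 2 + n) * b″))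
          + n * ((b - b′) - (b′ - b″)))
        ≡ ((+ 2 + k) + + 1) * a + (+ 2 + n - (+ 2 + k)) * a′
        + (((+ 2 + k) + + 1) * (((+ 2 + k) + + 1) * + 1) + (+ 2 + n) - + 2) * b
        + (+ 2 * (+ 2 + k) * (+ 2 + n - (+ 2 + k) - + 1) - (+ 2 + n) + + 3) * b′
        + ((+ 2 + n - (+ 2 + k)) * ((+ 2 + n - (+ 2 + k)) * + 1) + (+ 2 + n) - + 2) * b″
      lem = solve-∀

-- Recurrences from logarithmic derivatives.

module LogarithmicDerivative where

  open import Data.Nat.Base
  open import Data.Nat.Properties
  open import Data.Nat.Tactic.RingSolver using (solve-∀)

  -- The recurrence says that the generating function of c has logarithmic
  -- derivative p/(1 - u) + 2qu/(1 - u²), as (1 - u)^-p (1 - u²)^-q has.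
  record Rec (p q : ℕ) (c : ℕ → ℕ) : Set where
    field
      rec₁ : c 1 ≡ p * c 0
      rec₂ : ∀ n → (2 + n) * c (2 + n) ≡ p * c (1 + n) + (p + 2 * q + n) * c n

  open Rec

  module _ {p q} {c c′ : ℕ → ℕ} (R : Rec p q c) where

    -- Here c′ is c multiplied by 1/(1 - u), which adds 1/(1 - u) to the logarithmic derivative and
    -- so 1 to p. Over ℕ this is an induction on n: in (2 + n) c′ (2 + n), the part from c obeys its
    -- own recurrence, and the part (1 + n) c′ (1 + n) obeys the one being proved, one index
    -- earlier.
    Rec-weight₁ : c′ 0 ≡ c 0 → (∀ n → c′ (1 + n) ≡ c (1 + n) + c′ n) → Rec (1 + p) q c′
    Rec-weight₁ c′0 c′+ .rec₁ = begin
      c′ 1           ≡⟨ c′+ 0 ⟩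
      c 1 + c′ 0     ≡⟨ cong₂ _+_ (rec₁ R) c′0 ⟩
      p * c 0 + c 0  ≡⟨ +-comm (p * c 0) (c 0) ⟩
      (1 + p) * c 0  ≡⟨ cong ((1 + p) *_) c′0 ⟨
      (1 + p) * c′ 0 ∎
      where open ≡-Reasoning
    Rec-weight₁ c′0 c′+ .rec₂ n = begin
      (2 + n) * c′ (2 + n)
        ≡⟨ cong ((2 + n) *_) (c′+ (1 + n)) ⟩
      (2 + n) * (c (2 + n) + c′ (1 + n))
        ≡⟨ lem₁ n (c (2 + n)) (c′ (1 + n)) ⟩
      (2 + n) * c (2 + n) + ((1 + n) * c′ (1 + n) + c′ (1 + n))
        ≡⟨ cong₂ (λ x y → x + (y + c′ (1 + n))) (rec₂ R n) (scaled n) ⟩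
      p * c (1 + n) + (p + 2 * q + n) * c n + ((p * c′ n + s n) + c′ (1 + n))
        ≡⟨ lem₂ p (c (1 + n)) (c′ n) (c′ (1 + n)) _ (s n) ⟩
      p * (c (1 + n) + c′ n) + ((p + 2 * q + n) * c n + s n) + c′ (1 + n)
        ≡⟨ cong₂ (λ x y → p * x + y + c′ (1 + n)) (sym (c′+ n)) (total n) ⟩
      p * c′ (1 + n) + (1 + p + 2 * q + n) * c′ n + c′ (1 + n)
        ≡⟨ lem₃ p (c′ (1 + n)) _ ⟩
      (1 + p) * c′ (1 + n) + (1 + p + 2 * q + n) * c′ n ∎
      where
      open ≡-Reasoning
      -- The value of (1 + n) c′ (1 + n) - p c′ n, spelled out without subtraction: at 0 it comes
      -- from `rec₁`, later from the preceding instance of `rec₂`.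
      s : ℕ → ℕ
      s zero    = c′ 0
      s (suc n) = c′ (1 + n) + (p + 2 * q + (1 + n)) * c′ n
      lem₁ : ∀ n x y → (2 + n) * (x + y) ≡ (2 + n) * x + ((1 + n) * y + y)
      lem₁ = solve-∀
      lem₂ : ∀ p a b d x y → p * a + x + ((p * b + y) + d) ≡ p * (a + b) + (x + y) + d
      lem₂ = solve-∀
      lem₃ : ∀ p a x → p * a + x + a ≡ (1 + p) * a + x
      lem₃ = solve-∀
      scaled : ∀ n → (1 + n) * c′ (1 + n) ≡ p * c′ n + s n
      -- For positive n, c n and the c′ (n - 1) inside `s n` carry the same factor and add up to c′
      -- n.
      total  : ∀ n → (p + 2 * q + n) * c n + s n ≡ (1 + p + 2 * q + n) * c′ n
      scaled zero = begin
        1 * c′ 1          ≡⟨ *-identityˡ (c′ 1) ⟩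
        c′ 1              ≡⟨ Rec-weight₁ c′0 c′+ .rec₁ ⟩
        c′ 0 + p * c′ 0   ≡⟨ +-comm (c′ 0) _ ⟩
        p * c′ 0 + c′ 0   ∎
      scaled (suc n) = begin
        (2 + n) * c′ (2 + n)                               ≡⟨ Rec-weight₁ c′0 c′+ .rec₂ n ⟩
        (1 + p) * c′ (1 + n) + (1 + p + 2 * q + n) * c′ n  ≡⟨ lem p q n (c′ (1 + n)) (c′ n) ⟩
        p * c′ (1 + n) + s (suc n)                         ∎
        where
        lem : ∀ p q n a b → (1 + p) * a + (1 + p + 2 * q + n) * b
                          ≡ p * a + (a + (p + 2 * q + (1 + n)) * b)
        lem = solve-∀
      total zero rewrite c′0 = +-comm _ (c 0)
      total (suc n) = begin
        m * c (1 + n) + (c′ (1 + n) + m * c′ n)  ≡⟨ lem m (c (1 + n)) (c′ (1 + n)) (c′ n) ⟩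
        c′ (1 + n) + m * (c (1 + n) + c′ n)      ≡⟨ cong (λ x → c′ (1 + n) + m * x) (c′+ n) ⟨
        (1 + m) * c′ (1 + n)                     ∎
        where
        m = p + 2 * q + (1 + n)
        lem : ∀ m a b d → m * a + (b + m * d) ≡ b + m * (a + d)
        lem = solve-∀

    -- Multiplication by 1/(1 - u²) adds 2u/(1 - u²) to the logarithmic derivative and so 1 to q.
    Rec-weight₂ : c′ 0 ≡ c 0 → c′ 1 ≡ c 1 → (∀ n → c′ (2 + n) ≡ c (2 + n) + c′ n) →
                  Rec p (1 + q) c′
    Rec-weight₂ c′0 c′1 c′+ .rec₁ rewrite c′0 | c′1 = rec₁ R
    Rec-weight₂ c′0 c′1 c′+ .rec₂ n = begin
      (2 + n) * c′ (2 + n)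
        ≡⟨ cong ((2 + n) *_) (c′+ n) ⟩
      (2 + n) * (c (2 + n) + c′ n)
        ≡⟨ lem₁ n (c (2 + n)) (c′ n) ⟩
      (2 + n) * c (2 + n) + n * c′ n + 2 * c′ n
        ≡⟨ cong (_+ 2 * c′ n) (go n) ⟩
      p * c′ (1 + n) + (p + 2 * q + n) * c′ n + 2 * c′ n
        ≡⟨ lem₂ p q n (c′ (1 + n)) (c′ n) ⟩
      p * c′ (1 + n) + (p + 2 * (1 + q) + n) * c′ n ∎
      where
      open ≡-Reasoning
      lem₁ : ∀ n x y → (2 + n) * (x + y) ≡ (2 + n) * x + n * y + 2 * y
      lem₁ = solve-∀
      lem₂ : ∀ p q n a b → p * a + (p + 2 * q + n) * b + 2 * b
                         ≡ p * a + (p + 2 * (1 + q) + n) * b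
      lem₂ = solve-∀
      -- At index n + 2 this is the sum of the recurrence for c there and the one for c′ at n. At 1,
      -- where no earlier instance exists, `rec₁` takes its place.
      go : ∀ n → (2 + n) * c (2 + n) + n * c′ n ≡ p * c′ (1 + n) + (p + 2 * q + n) * c′ n
      go zero rewrite c′0 | c′1 = trans (+-identityʳ _) (rec₂ R 0)
      go (suc zero) rewrite c′+ 0 | c′0 | c′1 = begin
        3 * c 3 + 1 * c 1                               ≡⟨ cong (_+ 1 * c 1) (rec₂ R 1) ⟩
        p * c 2 + (p + 2 * q + 1) * c 1 + 1 * c 1       ≡⟨ cong (λ x → p * c 2 + (p + 2 * q + 1) * c 1 + 1 * x) (rec₁ R) ⟩
        p * c 2 + (p + 2 * q + 1) * c 1 + 1 * (p * c 0) ≡⟨ lem p (c 2) ((p + 2 * q + 1) * c 1) (c 0) ⟩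
        p * (c 2 + c 0) + (p + 2 * q + 1) * c 1         ∎
        where
        lem : ∀ p a x b → p * a + x + 1 * (p * b) ≡ p * (a + b) + x
        lem = solve-∀
      go (suc (suc n)) = begin
        (4 + n) * c (4 + n) + (2 + n) * c′ (2 + n)
          ≡⟨ cong₂ _+_ (rec₂ R (2 + n)) (Rec-weight₂ c′0 c′1 c′+ .rec₂ n) ⟩
        p * c (3 + n) + (p + 2 * q + (2 + n)) * c (2 + n)
          + (p * c′ (1 + n) + (p + 2 * (1 + q) + n) * c′ n)
          ≡⟨ lem p q n (c (3 + n)) (c (2 + n)) (c′ (1 + n)) (c′ n) ⟩
        p * (c (3 + n) + c′ (1 + n)) + (p + 2 * q + (2 + n)) * (c (2 + n) + c′ n)
          ≡⟨ cong₂ (λ x y → p * x + (p + 2 * q + (2 + n)) * y) (c′+ (1 + n)) (c′+ n) ⟨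
        p * c′ (3 + n) + (p + 2 * q + (2 + n)) * c′ (2 + n) ∎
        where
        lem : ∀ p q n a b d e →
          p * a + (p + 2 * q + (2 + n)) * b + (p * d + (p + 2 * (1 + q) + n) * e)
          ≡ p * (a + d) + (p + 2 * q + (2 + n)) * (b + e)
        lem = solve-∀

-- Enumeration of symmetric matrices over ℕ by total.

module SymmetricMatrices where

  open import Data.Fin.Base using (Fin; zero; suc)
  import Data.Fin.Properties as Fin
  open import Data.Nat.Base
  open import Data.Nat.Properties
  open import Data.Nat.Tactic.RingSolver using (solve-∀)
  open LogarithmicDerivative
  open import Algebra.Properties.Semiring.Sum +-*-semiring using (sum; sum-syntax; ∑-distrib-+)

  private variable
    A B : Set
    r : ℕ

  Unique⇒lookup-injective : {xs : List A} → Unique xs → ∀ i j →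
                            List.lookup xs i ≡ List.lookup xs j → i ≡ j
  Unique⇒lookup-injective {xs = x ∷ xs} u zero zero eq = refl
  Unique⇒lookup-injective {xs = x ∷ xs} (x∉ ∷ u) zero (suc j) eq =
    ⊥-elim (All.lookup x∉ (∈-lookup j) eq)
  Unique⇒lookup-injective {xs = x ∷ xs} (x∉ ∷ u) (suc i) zero eq =
    ⊥-elim (All.lookup x∉ (∈-lookup i) (sym eq))
  Unique⇒lookup-injective {xs = x ∷ xs} (_ ∷ u) (suc i) (suc j) eq =
    cong suc (Unique⇒lookup-injective u i j eq)

  -- Choosing a related entry of ys for every index of xs gives an injection of index sets. With a
  -- relation in place of a function, `length-≡` can use the graph of f in both directions.
  length-≤ : {xs : List A} {ys : List B} (R : A → B → Set) → Unique xs →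
             (∀ {x} → x ∈ xs → ∃ λ y → y ∈ ys × R x y) →
             (∀ {x x′ y} → x ∈ xs → x′ ∈ xs → R x y → R x′ y → x ≡ x′) →
             length xs ≤ length ys
  length-≤ {xs = xs} {ys} R u total inj = Fin.injective⇒≤ {f = f} f-injective
    where
    pick : ∀ i → ∃ λ y → y ∈ ys × R (List.lookup xs i) y
    pick i = total (∈-lookup i)
    f : Fin (length xs) → Fin (length ys)
    f i = Any.index (proj₁ (proj₂ (pick i)))
    f-lookup : ∀ i → R (List.lookup xs i) (List.lookup ys (f i))
    f-lookup i with pick i
    ... | y , y∈ys , Rxy = subst (R _) (lookup-index y∈ys) Rxy
    f-injective : ∀ {i j} → f i ≡ f j → i ≡ j
    f-injective {i} {j} eq = Unique⇒lookup-injective u i j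
      (inj (∈-lookup i) (∈-lookup j) (f-lookup i)
        (subst (R _) (cong (List.lookup ys) (sym eq)) (f-lookup j)))

  length-≡ : {xs : List A} {ys : List B} (f : A → B) → Unique xs → Unique ys →
             (∀ {x} → x ∈ xs → f x ∈ ys) →
             (∀ {x x′} → x ∈ xs → x′ ∈ xs → f x ≡ f x′ → x ≡ x′) →
             (∀ {y} → y ∈ ys → ∃ λ x → x ∈ xs × f x ≡ y) →
             length xs ≡ length ys
  length-≡ f xs! ys! f∈ inj surj = ≤-antisym
    (length-≤ (λ x y → f x ≡ y) xs! (λ x∈ → _ , f∈ x∈ , refl)
      (λ x∈ x′∈ eq eq′ → inj x∈ x′∈ (trans eq (sym eq′))))
    (length-≤ (λ y x → f x ≡ y) ys! surj (λ _ _ eq eq′ → trans (sym eq) eq′))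

  module _ (g : A → List B) where

    pairs : List A → List (A × B)
    pairs = concatMap (λ x → List.map (x ,_) (g x))

    ∈-pairs⁺ : ∀ {x y xs} → x ∈ xs → y ∈ g x → (x , y) ∈ pairs xs
    ∈-pairs⁺ {xs = x ∷ xs} (here refl) y∈ = ∈-++⁺ˡ (∈-map⁺ (x ,_) y∈)
    ∈-pairs⁺ {xs = x ∷ xs} (there x∈)  y∈ = ∈-++⁺ʳ (List.map (x ,_) (g x)) (∈-pairs⁺ x∈ y∈)

    ∈-pairs⁻ : ∀ {x y} xs → (x , y) ∈ pairs xs → x ∈ xs × y ∈ g x
    ∈-pairs⁻ (x ∷ xs) p with ∈-++⁻ (List.map (x ,_) (g x)) p
    ... | inj₁ q with _ , y∈ , refl ← ∈-map⁻ (x ,_) q = here refl , y∈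
    ... | inj₂ q = map₁ there (∈-pairs⁻ xs q)

    pairs! : ∀ {xs} → Unique xs → (∀ x → Unique (g x)) → Unique (pairs xs)
    pairs! {xs = []}     []         g! = []
    pairs! {xs = x ∷ xs} u@(_ ∷ xs!) g! =
      Unique.++⁺ (Unique.map⁺ ,-injectiveʳ (g! x)) (pairs! xs! g!) disjoint
      where
      disjoint : ∀ {p} → p ∈ List.map (x ,_) (g x) × p ∈ pairs xs → _
      disjoint (p , q) with _ , _ , refl ← ∈-map⁻ (x ,_) p =
        Unique[x∷xs]⇒x∉xs u (proj₁ (∈-pairs⁻ xs q))

  -- A combinatorial model of a generating function: the sum of u^(`weight x`) over all x has the
  -- coefficients `length ∘ e`.
  record Enumerates (e : ℕ → List A) (weight : A → ℕ) : Set where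
    field
      unique   : ∀ n → Unique (e n)
      sound    : ∀ n {x} → x ∈ e n → weight x ≡ n
      complete : ∀ x → x ∈ e (weight x)

  open Enumerates

  fresh : A → ℕ × A
  fresh x = 0 , x

  bump : ℕ × A → ℕ × A
  bump (k , x) = suc k , x

  -- Models of multiplication by 1/(1 - u) and 1/(1 - u²): the new coordinate is either 0 or a
  -- successor, and lowering it by one frees weight 1 or 2.
  coin₁ coin₂ : (ℕ → List A) → ℕ → List (ℕ × A)

  coin₁ e zero    = List.map fresh (e zero)
  coin₁ e (suc n) = List.map fresh (e (suc n)) ++ List.map bump (coin₁ e n)

  coin₂ e zero          = List.map fresh (e zero)
  coin₂ e (suc zero)    = List.map fresh (e (suc zero))
  coin₂ e (suc (suc n)) = List.map fresh (e (suc (suc n))) ++ List.map bump (coin₂ e n)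

  bump-injective : {x y : ℕ × A} → bump x ≡ bump y → x ≡ y
  bump-injective refl = refl

  bump-unique : {xs : List A} {ys : List (ℕ × A)} → Unique xs → Unique ys →
                Unique (List.map fresh xs ++ List.map bump ys)
  bump-unique {xs = xs} {ys} xs! ys! =
    Unique.++⁺ (Unique.map⁺ ,-injectiveʳ xs!) (Unique.map⁺ bump-injective ys!) disjoint
    where
    disjoint : ∀ {p} → p ∈ List.map fresh xs × p ∈ List.map bump ys → _
    disjoint (p , q) with ∈-map⁻ fresh p | ∈-map⁻ bump q
    ... | _ , _ , refl | _ , _ , ()

  module _ {e : ℕ → List A} {weight : A → ℕ} (E : Enumerates e weight) where

    coin₁-enumerates : Enumerates (coin₁ e) (λ (k , x) → k + weight x)
    coin₁-enumerates .unique zero    = Unique.map⁺ ,-injectiveʳ (E .unique 0)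
    coin₁-enumerates .unique (suc n) = bump-unique (E .unique (suc n)) (coin₁-enumerates .unique n)
    coin₁-enumerates .sound zero p with _ , x∈ , refl ← ∈-map⁻ fresh p = E .sound 0 x∈
    coin₁-enumerates .sound (suc n) p with ∈-++⁻ (List.map fresh (e (suc n))) p
    ... | inj₁ q with _ , x∈ , refl ← ∈-map⁻ fresh q = E .sound (suc n) x∈
    ... | inj₂ q with _ , x∈ , refl ← ∈-map⁻ bump q = cong suc (coin₁-enumerates .sound n x∈)
    coin₁-enumerates .complete (zero , x) with weight x | E .complete x
    ... | zero  | x∈ = ∈-map⁺ fresh x∈
    ... | suc _ | x∈ = ∈-++⁺ˡ (∈-map⁺ fresh x∈)
    coin₁-enumerates .complete (suc k , x) =
      ∈-++⁺ʳ (List.map fresh (e _)) (∈-map⁺ bump (coin₁-enumerates .complete (k , x)))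

    coin₂-enumerates : Enumerates (coin₂ e) (λ (k , x) → k * 2 + weight x)
    coin₂-enumerates .unique zero          = Unique.map⁺ ,-injectiveʳ (E .unique 0)
    coin₂-enumerates .unique (suc zero)    = Unique.map⁺ ,-injectiveʳ (E .unique 1)
    coin₂-enumerates .unique (suc (suc n)) =
      bump-unique (E .unique (suc (suc n))) (coin₂-enumerates .unique n)
    coin₂-enumerates .sound zero p with _ , x∈ , refl ← ∈-map⁻ fresh p = E .sound 0 x∈
    coin₂-enumerates .sound (suc zero) p with _ , x∈ , refl ← ∈-map⁻ fresh p = E .sound 1 x∈
    coin₂-enumerates .sound (suc (suc n)) p with ∈-++⁻ (List.map fresh (e (suc (suc n)))) p
    ... | inj₁ q with _ , x∈ , refl ← ∈-map⁻ fresh q = E .sound (suc (suc n)) x∈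
    ... | inj₂ q with _ , x∈ , refl ← ∈-map⁻ bump q =
      cong (2 +_) (coin₂-enumerates .sound n x∈)
    coin₂-enumerates .complete (zero , x) with weight x | E .complete x
    ... | zero        | x∈ = ∈-map⁺ fresh x∈
    ... | suc zero    | x∈ = ∈-map⁺ fresh x∈
    ... | suc (suc _) | x∈ = ∈-++⁺ˡ (∈-map⁺ fresh x∈)
    coin₂-enumerates .complete (suc k , x) =
      ∈-++⁺ʳ (List.map fresh (e _)) (∈-map⁺ bump (coin₂-enumerates .complete (k , x)))

  length-bump : (xs : List A) (ys : List (ℕ × A)) →
                length (List.map fresh xs ++ List.map bump ys) ≡ length xs + length ys
  length-bump xs ys = trans (length-++ (List.map fresh xs))
    (cong₂ _+_ (length-map fresh xs) (length-map bump ys))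

  module _ {p q} {e : ℕ → List A} (R : Rec p q (length ∘ e)) where

    coin₁-Rec : Rec (1 + p) q (length ∘ coin₁ e)
    coin₁-Rec = Rec-weight₁ R (length-map fresh (e 0))
      (λ n → length-bump (e (suc n)) (coin₁ e n))

    coin₂-Rec : Rec p (1 + q) (length ∘ coin₂ e)
    coin₂-Rec = Rec-weight₂ R (length-map fresh (e 0)) (length-map fresh (e 1))
      (λ n → length-bump (e (suc (suc n))) (coin₂ e n))

  -- `B`, the type of what follows the row, sits innermost, so that each entry of the row is one
  -- `coin₂` step over an enumeration of the rest.
  Row : ℕ → Set → Set
  Row zero    B = B
  Row (suc k) B = ℕ × Row k B

  -- A symmetric matrix over ℕ, given by its first diagonal entry, the remaining entries of
  -- the first row, and the matrix without its first row and column.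
  Sym : ℕ → Set
  Sym zero    = ⊤
  Sym (suc r) = ℕ × Row r (Sym r)

  cell : ∀ k → Row k B → Fin k → ℕ
  cell (suc k) (x , ρ) zero    = x
  cell (suc k) (x , ρ) (suc i) = cell k ρ i

  rest : ∀ k → Row k B → B
  rest zero    b       = b
  rest (suc k) (x , ρ) = rest k ρ

  row : ∀ k → (Fin k → ℕ) → B → Row k B
  row zero    f b = b
  row (suc k) f b = f zero , row k (f ∘ suc) b

  entry : Sym r → Fin r → Fin r → ℕ
  entry {suc r} (x , ρ) zero    zero    = x
  entry {suc r} (x , ρ) zero    (suc j) = cell r ρ j
  entry {suc r} (x , ρ) (suc i) zero    = cell r ρ i
  entry {suc r} (x , ρ) (suc i) (suc j) = entry (rest r ρ) i j

  fromEntries : (Fin r → Fin r → ℕ) → Sym r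
  fromEntries {zero}  f = tt
  fromEntries {suc r} f =
    f zero zero , row r (λ j → f zero (suc j)) (fromEntries (λ i j → f (suc i) (suc j)))

  entry-sym : (a : Sym r) → ∀ i j → entry a i j ≡ entry a j i
  entry-sym {suc r} a       zero    zero    = refl
  entry-sym {suc r} a       zero    (suc j) = refl
  entry-sym {suc r} a       (suc i) zero    = refl
  entry-sym {suc r} (x , ρ) (suc i) (suc j) = entry-sym (rest r ρ) i j

  cell-row : ∀ k f (b : B) i → cell k (row k f b) i ≡ f i
  cell-row (suc k) f b zero    = refl
  cell-row (suc k) f b (suc i) = cell-row k (f ∘ suc) b i

  rest-row : ∀ k f (b : B) → rest k (row k f b) ≡ b
  rest-row zero    f b = refl
  rest-row (suc k) f b = rest-row k (f ∘ suc) b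

  row-cell : ∀ k (ρ : Row k B) {f b} → f ≗ cell k ρ → b ≡ rest k ρ → row k f b ≡ ρ
  row-cell zero    ρ       eq eq′ = eq′
  row-cell (suc k) (x , ρ) eq eq′ = cong₂ _,_ (eq zero) (row-cell k ρ (eq ∘ suc) eq′)

  entry-fromEntries : (f : Fin r → Fin r → ℕ) → (∀ i j → f i j ≡ f j i) →
                      ∀ i j → entry (fromEntries f) i j ≡ f i j
  entry-fromEntries {suc r} f f-sym zero    zero    = refl
  entry-fromEntries {suc r} f f-sym zero    (suc j) = cell-row r _ _ j
  entry-fromEntries {suc r} f f-sym (suc i) zero    =
    trans (cell-row r _ _ i) (f-sym zero (suc i))
  entry-fromEntries {suc r} f f-sym (suc i) (suc j) = trans
    (cong (λ a → entry a i j) (rest-row r _ _))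
    (entry-fromEntries _ (λ i j → f-sym (suc i) (suc j)) i j)

  fromEntries-entry : (a : Sym r) {f : Fin r → Fin r → ℕ} → (∀ i j → f i j ≡ entry a i j) →
                      fromEntries f ≡ a
  fromEntries-entry {zero}  tt      eq = refl
  fromEntries-entry {suc r} (x , ρ) eq = cong₂ _,_ (eq zero zero)
    (row-cell r ρ (eq zero ∘ suc) (fromEntries-entry (rest r ρ) λ i j → eq (suc i) (suc j)))

  -- An entry off the diagonal fills two cells of the matrix, hence the factor 2.
  row-weight : ∀ k → (B → ℕ) → Row k B → ℕ
  row-weight zero    f b       = f b
  row-weight (suc k) f (x , ρ) = x * 2 + row-weight k f ρ

  weight : ∀ r → Sym r → ℕ
  weight zero    tt      = 0
  weight (suc r) (x , ρ) = x + row-weight r (weight r) ρ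

  total : ∀ r → Sym r → ℕ
  total r a = ∑[ i < r ] ∑[ j < r ] entry a i j

  row-weight-sum : ∀ k (f : B → ℕ) ρ →
                   row-weight k f ρ ≡ sum (cell k ρ) + sum (cell k ρ) + f (rest k ρ)
  row-weight-sum zero    f b       = refl
  row-weight-sum (suc k) f (x , ρ) = trans (cong (x * 2 +_) (row-weight-sum k f ρ))
    (lem x (sum (cell k ρ)) (f (rest k ρ)))
    where
    lem : ∀ x s y → x * 2 + (s + s + y) ≡ x + s + (x + s) + y
    lem = solve-∀

  -- The first row and the first column each contribute s beyond the diagonal entry. One s stays in
  -- the first row, the other is spread over the remaining rows.
  weight≡total : ∀ r a → weight r a ≡ total r a
  weight≡total zero    tt      = refl
  weight≡total (suc r) (x , ρ) = begin
    x + row-weight r (weight r) ρ         ≡⟨ cong (x +_) (row-weight-sum r (weight r) ρ) ⟩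
    x + (s + s + weight r (rest r ρ))     ≡⟨ cong (λ y → x + (s + s + y)) (weight≡total r (rest r ρ)) ⟩
    x + (s + s + total r (rest r ρ))      ≡⟨ lem x s (total r (rest r ρ)) ⟩
    x + s + (s + total r (rest r ρ))      ≡⟨ cong (x + s +_) (∑-distrib-+ (cell r ρ) _) ⟨
    total (suc r) (x , ρ)                 ∎
    where
    open ≡-Reasoning
    s = sum (cell r ρ)
    lem : ∀ x s y → x + (s + s + y) ≡ x + s + (s + y)
    lem = solve-∀

  rows : ∀ k → (ℕ → List B) → ℕ → List (Row k B)
  rows zero    e = e
  rows (suc k) e = coin₂ (rows k e)

  syms : ∀ r → ℕ → List (Sym r)
  syms zero    zero    = tt ∷ []
  syms zero    (suc _) = []
  syms (suc r)         = coin₁ (rows r (syms r))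

  rows-enumerates : ∀ k {e : ℕ → List B} {f} → Enumerates e f →
                    Enumerates (rows k e) (row-weight k f)
  rows-enumerates zero    E = E
  rows-enumerates (suc k) E = coin₂-enumerates (rows-enumerates k E)

  syms-enumerates : ∀ r → Enumerates (syms r) (weight r)
  syms-enumerates zero .unique zero            = [] ∷ []
  syms-enumerates zero .unique (suc n)         = []
  syms-enumerates zero .sound  zero (here refl) = refl
  syms-enumerates zero .complete tt            = here refl
  syms-enumerates (suc r) = coin₁-enumerates (rows-enumerates r (syms-enumerates r))

  rows-Rec : ∀ k {p q} {e : ℕ → List B} → Rec p q (length ∘ e) → Rec p (k + q) (length ∘ rows k e)
  rows-Rec zero    R = R
  rows-Rec (suc k) R = coin₂-Rec (rows-Rec k R)

  -- The number r(r - 1)/2 of cells above the diagonal.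
  triangle : ℕ → ℕ
  triangle zero    = 0
  triangle (suc r) = r + triangle r

  -- Each diagonal entry gives a factor 1/(1 - u), each cell above the diagonal a factor 1/(1 - u²).
  -- The empty matrix has generating function 1, for which `rec₂` amounts to the vanishing of n c n.
  syms-Rec : ∀ r → Rec r (triangle r) (length ∘ syms r)
  syms-Rec zero .Rec.rec₁ = refl
  syms-Rec zero .Rec.rec₂ n = trans (*-zeroʳ n) (sym (n*syms n))
    where
    n*syms : ∀ n → n * length (syms 0 n) ≡ 0
    n*syms zero    = refl
    n*syms (suc n) = *-zeroʳ n
  syms-Rec (suc r) = coin₁-Rec (rows-Rec r (syms-Rec r))

  -- This turns the coefficient p + 2q + n of `rec₂` into r² + n.
  r+2*triangle : ∀ r → r + 2 * triangle r ≡ r * r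
  r+2*triangle zero    = refl
  r+2*triangle (suc r) = trans (lem₁ r (triangle r)) (trans (cong (λ x → 1 + r + r + x) (r+2*triangle r)) (lem₂ r))
    where
    lem₁ : ∀ r t → 1 + r + 2 * (r + t) ≡ 1 + r + r + (r + 2 * t)
    lem₁ = solve-∀
    lem₂ : ∀ r → 1 + r + r + r * r ≡ (1 + r) * (1 + r)
    lem₂ = solve-∀

-- Involutions with compatible words versus symmetric matrices.

module Correspondence where

  open import Data.Fin.Base using (Fin; zero; suc; toℕ; _<_; combine; cast; _↑ˡ_; _↑ʳ_; splitAt)
  open import Data.Fin.Induction using (<-wellFounded)
  open import Data.Fin.Permutation using (permutation)
  import Data.Fin.Properties as Fin
  open import Data.Nat.Base as ℕ using (ℕ; zero; suc; _+_; _*_; _∸_; z≤n; s≤s)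
  open import Data.Nat.Properties
  open import Induction.WellFounded using (Acc; acc)
  open import Algebra.Properties.Semiring.Sum +-*-semiring

  private variable
    k n r : ℕ

  δ : Fin r → Fin r → ℕ
  δ zero    zero    = 1
  δ zero    (suc j) = 0
  δ (suc i) zero    = 0
  δ (suc i) (suc j) = δ i j

  ∑-δ : ∀ i (f : Fin r → ℕ) → ∑[ j < r ] (δ i j * f j) ≡ f i
  ∑-δ {suc r} zero    f = trans (cong (f zero + 0 +_) (sum-replicate-zero r))
    (trans (+-identityʳ _) (+-identityʳ _))
  ∑-δ {suc r} (suc i) f = ∑-δ i (f ∘ suc)

  Lex : (Fin n → Fin n) → (Fin n → Fin r) → Fin n → Fin n → Set
  Lex π w i j = w i < w j ⊎ (w i ≡ w j × π i < π j)

  -- For an injective π this means that w increases weakly, and strictly at the descents of π.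
  -- Quantifying over all i < j lets distant positions be compared directly.
  Compatible : (Fin n → Fin n) → (Fin n → Fin r) → Set
  Compatible π w = ∀ i j → i < j → Lex π w i j

  -- The matrix A of the pair (π , w), each cardinality being a sum of products of indicators.
  count : (Fin n → Fin n) → (Fin n → Fin r) → Fin r → Fin r → ℕ
  count {n} π w i j = ∑[ m < n ] (δ (w m) i * δ (w (π m)) j)

  -- Group the positions m by their cell (w m , w (π m)). The weight `g` is arbitrary so as to yield
  -- both the total of the matrix and the sums of any function of the cells.
  ∑-count : ∀ (π : Fin n → Fin n) (w : Fin n → Fin r) (g : Fin r → Fin r → ℕ) →
            ∑[ i < r ] ∑[ j < r ] (count π w i j * g i j) ≡ ∑[ m < n ] g (w m) (w (π m))
  ∑-count {n} {r} π w g = begin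
    ∑[ i < r ] ∑[ j < r ] (count π w i j * g i j)
      ≡⟨ sum-cong-≗ (λ i → sum-cong-≗ λ j → trans (*-distribʳ-sum {n} (g i j) _)
           (sum-cong-≗ {n} λ m → *-assoc (δ (w m) i) (δ (w (π m)) j) (g i j))) ⟩
    ∑[ i < r ] ∑[ j < r ] ∑[ m < n ] (δ (w m) i * (δ (w (π m)) j * g i j))
      ≡⟨ sum-cong-≗ {r} (λ i → ∑-comm {r} {n} _) ⟩
    ∑[ i < r ] ∑[ m < n ] ∑[ j < r ] (δ (w m) i * (δ (w (π m)) j * g i j))
      ≡⟨ sum-cong-≗ {r} (λ i → sum-cong-≗ {n} λ m → trans (sym (*-distribˡ-sum {r} (δ (w m) i) _))
           (cong (δ (w m) i *_) (∑-δ (w (π m)) (g i)))) ⟩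
    ∑[ i < r ] ∑[ m < n ] (δ (w m) i * g i (w (π m)))
      ≡⟨ ∑-comm {r} {n} _ ⟩
    ∑[ m < n ] ∑[ i < r ] (δ (w m) i * g i (w (π m)))
      ≡⟨ sum-cong-≗ {n} (λ m → ∑-δ (w m) (λ i → g i (w (π m)))) ⟩
    ∑[ m < n ] g (w m) (w (π m)) ∎
    where open ≡-Reasoning

  ∑-const : ∀ n c → ∑[ i < n ] c ≡ n * c
  ∑-const zero    c = refl
  ∑-const (suc n) c = cong (c +_) (∑-const n c)

  total-count : ∀ (π : Fin n → Fin n) (w : Fin n → Fin r) →
                ∑[ i < r ] ∑[ j < r ] count π w i j ≡ n
  total-count {n} {r} π w = begin
    ∑[ i < r ] ∑[ j < r ] count π w i j
      ≡⟨ sum-cong-≗ {r} (λ i → sum-cong-≗ {r} λ j → *-identityʳ (count π w i j)) ⟨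
    ∑[ i < r ] ∑[ j < r ] (count π w i j * 1)
      ≡⟨ ∑-count π w (λ _ _ → 1) ⟩
    ∑[ m < n ] 1
      ≡⟨ trans (∑-const n 1) (*-identityʳ n) ⟩
    n ∎
    where open ≡-Reasoning

  -- Reindexing the sum by the bijection π exchanges the two indicators, since π (π m) = m.
  count-sym : ∀ {π : Fin n → Fin n} (w : Fin n → Fin r) → Involutive _≡_ π →
              ∀ i j → count π w i j ≡ count π w j i
  count-sym {n} {r} {π} w inv i j = begin
    ∑[ m < n ] (δ (w m) i * δ (w (π m)) j)
      ≡⟨ ∑-permute (λ m → δ (w m) i * δ (w (π m)) j) (permutation π π inv inv) ⟩
    ∑[ m < n ] (δ (w (π m)) i * δ (w (π (π m))) j)
      ≡⟨ sum-cong-≗ {n} (λ m → trans (*-comm (δ (w (π m)) i) _)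
           (cong (λ l → δ (w l) j * δ (w (π m)) i) (inv m))) ⟩
    ∑[ m < n ] (δ (w m) j * δ (w (π m)) i) ∎
    where open ≡-Reasoning

  Monotone : (Fin n → ℕ) → Set
  Monotone f = ∀ i j → i < j → f i ℕ.≤ f j

  private
    -- Otherwise every value of g exceeds `f zero`, and the indicator `h` has sum 0 over g but at
    -- least 1 over f.
    head-≤ : ∀ (f g : Fin (suc n) → ℕ) → Monotone g →
             (∀ (h : ℕ → ℕ) → sum (h ∘ f) ≡ sum (h ∘ g)) → g zero ℕ.≤ f zero
    head-≤ {n} f g g-mono same = ≮⇒≥ λ f₀<g₀ → 1+n≢0 (begin
      1 + sum (h ∘ f ∘ suc)      ≡⟨ cong (λ x → 1 ∸ x + sum (h ∘ f ∘ suc)) (n∸n≡0 (f zero)) ⟨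
      sum (h ∘ f)                ≡⟨ same h ⟩
      sum (h ∘ g)                ≡⟨ sum-cong-≗ (λ i → m≤n⇒m∸n≡0 (m<n⇒0<n∸m (<-≤-trans f₀<g₀ (g₀≤ i)))) ⟩
      ∑[ i < suc n ] 0           ≡⟨ sum-replicate-zero (suc n) ⟩
      0                          ∎)
      where
      open ≡-Reasoning
      -- The indicator of x ≤ f zero.
      h : ℕ → ℕ
      h x = 1 ∸ (x ∸ f zero)
      g₀≤ : ∀ i → g zero ℕ.≤ g i
      g₀≤ zero    = ≤-refl
      g₀≤ (suc i) = g-mono zero (suc i) (s≤s z≤n)

  -- Equal sums for every test function `h` mean equal multisets of values, and a weakly increasing
  -- sequence is its multiset in sorted order. The heads are the minima; they agree and cancel.
  monotone-unique : ∀ {f g : Fin n → ℕ} → Monotone f → Monotone g →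
                    (∀ (h : ℕ → ℕ) → sum (h ∘ f) ≡ sum (h ∘ g)) → f ≗ g
  monotone-unique {suc n} {f} {g} f-mono g-mono same = λ where
      zero    → f₀≡g₀
      (suc i) → monotone-unique
        (λ i j i<j → f-mono (suc i) (suc j) (s≤s i<j))
        (λ i j i<j → g-mono (suc i) (suc j) (s≤s i<j))
        (λ h → +-cancelˡ-≡ (h (f zero)) _ _
          (trans (same h) (cong (λ x → h x + sum (h ∘ g ∘ suc)) (sym f₀≡g₀)))) i
    where
    f₀≡g₀ : f zero ≡ g zero
    f₀≡g₀ = ≤-antisym (head-≤ g f f-mono (sym ∘ same)) (head-≤ f g g-mono same)

  -- The cell of m as one number, so that the lexicographic order of cells is the order of ℕ.
  key : (Fin n → Fin n) → (Fin n → Fin r) → Fin n → ℕ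
  key π w m = toℕ (combine (w m) (w (π m)))

  -- If the letters at i < j tie, then π i < π j, and compatibility at these two positions orders
  -- the second coordinates.
  key-monotone : ∀ {π : Fin n → Fin n} {w : Fin n → Fin r} → Compatible π w → Monotone (key π w)
  key-monotone {n} {r} {π} {w} compat i j i<j with compat i j i<j
  ... | inj₁ wi<wj = <⇒≤ (Fin.combine-monoˡ-< (w (π i)) (w (π j)) wi<wj)
  ... | inj₂ (wi≡wj , πi<πj) = begin
    toℕ (combine (w i) (w (π i)))   ≡⟨ Fin.toℕ-combine (w i) (w (π i)) ⟩
    r * toℕ (w i) + toℕ (w (π i))   ≤⟨ +-monoʳ-≤ (r * toℕ (w i)) (weak (compat (π i) (π j) πi<πj)) ⟩
    r * toℕ (w i) + toℕ (w (π j))   ≡⟨ cong (λ x → r * toℕ x + toℕ (w (π j))) wi≡wj ⟩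
    r * toℕ (w j) + toℕ (w (π j))   ≡⟨ Fin.toℕ-combine (w j) (w (π j)) ⟨
    toℕ (combine (w j) (w (π j)))   ∎
    where
    open ≤-Reasoning
    weak : ∀ {i j} → Lex π w i j → toℕ (w i) ℕ.≤ toℕ (w j)
    weak (inj₁ wi<wj)       = <⇒≤ wi<wj
    weak (inj₂ (wi≡wj , _)) = ≤-reflexive (cong toℕ wi≡wj)

  -- A compatible τ is increasing on positions with equal letters. If m came before τ l, then τ m
  -- would come before τ (τ l) = l.
  descend : ∀ {τ : Fin n → Fin n} {w : Fin n → Fin r} {m l} → Involutive _≡_ τ →
            Compatible τ w → l < τ m → w (τ l) ≡ w m → τ l < m
  descend {τ = τ} {w} {m} {l} inv compat l<τm same-block with Fin.<-cmp (τ l) m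
  ... | tri< τl<m _ _ = τl<m
  ... | tri≈ _ τl≡m _ = ⊥-elim (Fin.<-irrefl (trans (sym (inv l)) (cong τ τl≡m)) l<τm)
  ... | tri> _ _ m<τl with compat m (τ l) m<τl
  ...   | inj₁ wm<wτl = ⊥-elim (Fin.<-irrefl (sym same-block) wm<wτl)
  ...   | inj₂ (_ , τm<ττl) = ⊥-elim (Fin.<-asym l<τm (subst (τ m <_) (inv l) τm<ττl))

  module _ {π π′ : Fin n → Fin n} {w w′ : Fin n → Fin r}
    (inv : Involutive _≡_ π) (inv′ : Involutive _≡_ π′)
    (compat : Compatible π w) (compat′ : Compatible π′ w′)
    (same : ∀ i j → count π w i j ≡ count π′ w′ i j) where

    private
      -- By `∑-count` the matrix determines the multiset of keys, and both lists of keys are sorted.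
      key≗ : key π w ≗ key π′ w′
      key≗ = monotone-unique (key-monotone compat) (key-monotone compat′) λ h →
        begin
          ∑[ m < n ] h (key π w m)
            ≡⟨ ∑-count π w (λ i j → h (toℕ (combine i j))) ⟨
          ∑[ i < r ] ∑[ j < r ] (count π w i j * h (toℕ (combine i j)))
            ≡⟨ sum-cong-≗ {r} (λ i → sum-cong-≗ {r} λ j →
                 cong (_* h (toℕ (combine i j))) (same i j)) ⟩
          ∑[ i < r ] ∑[ j < r ] (count π′ w′ i j * h (toℕ (combine i j)))
            ≡⟨ ∑-count π′ w′ (λ i j → h (toℕ (combine i j))) ⟩
          ∑[ m < n ] h (key π′ w′ m) ∎
        where open ≡-Reasoning

      letters≡ : ∀ m → w m ≡ w′ m × w (π m) ≡ w′ (π′ m)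
      letters≡ m = Fin.combine-injective _ _ _ _ (Fin.toℕ-injective (key≗ m))

    word-unique : w ≗ w′
    word-unique m = proj₁ (letters≡ m)

    -- On the positions of one block of w that π sends into another given block, π and π′
    -- are increasing bijections onto the same set. So if π m < π′ m, then m′ = π′ (π m) is a
    -- smaller position in the block of m, and π m′ = π′ m′ = π m by induction, so m′ = m.
    perm-unique : π ≗ π′
    perm-unique m = go m (<-wellFounded m)
      where
      go : ∀ m → Acc _<_ m → π m ≡ π′ m
      go m (acc rs) with Fin.<-cmp (π m) (π′ m)
      ... | tri≈ _ eq _ = eq
      ... | tri< πm<π′m _ _ = ⊥-elim (Fin.<-irrefl m′≡m m′<m)
        where
        m′ = π′ (π m)
        m′<m = descend inv′ compat′ πm<π′m
          (trans (sym (proj₂ (letters≡ (π m)))) (trans (cong w (inv m)) (word-unique m)))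
        m′≡m = trans (sym (inv m′)) (trans (cong π (trans (go m′ (rs m′<m)) (inv′ (π m)))) (inv m))
      ... | tri> _ _ π′m<πm = ⊥-elim (Fin.<-irrefl m′≡m m′<m)
        where
        m′ = π (π′ m)
        m′<m = descend inv compat π′m<πm
          (trans (proj₂ (letters≡ (π′ m))) (trans (cong w′ (inv′ m)) (sym (word-unique m))))
        m′≡m = trans (sym (inv′ m′))
          (trans (cong π′ (trans (sym (go m′ (rs m′<m))) (inv (π′ m)))) (inv′ m))

  -- Blocks of sizes f 0, f 1, ... are laid end to end, so the order of `Fin (sum f)` is the
  -- lexicographic order of the pairs (i , x).
  enc : ∀ (f : Fin k → ℕ) i → Fin (f i) → Fin (sum f)
  enc {suc k} f zero    x = x ↑ˡ sum (f ∘ suc)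
  enc {suc k} f (suc i) x = f zero ↑ʳ enc (f ∘ suc) i x

  dec : ∀ (f : Fin k → ℕ) → Fin (sum f) → Σ[ i ∈ Fin k ] Fin (f i)
  dec {suc k} f m with splitAt (f zero) m
  ... | inj₁ x = zero , x
  ... | inj₂ y = let i , x = dec (f ∘ suc) y in suc i , x

  dec-enc : ∀ (f : Fin k → ℕ) i x → dec f (enc f i x) ≡ (i , x)
  dec-enc {suc k} f zero    x rewrite Fin.splitAt-↑ˡ (f zero) x (sum (f ∘ suc)) = refl
  dec-enc {suc k} f (suc i) x
    rewrite Fin.splitAt-↑ʳ (f zero) (sum (f ∘ suc)) (enc (f ∘ suc) i x)
          | dec-enc (f ∘ suc) i x = refl

  enc-dec : ∀ (f : Fin k → ℕ) m → let i , x = dec f m in enc f i x ≡ m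
  enc-dec {suc k} f m with splitAt (f zero) m in eq
  ... | inj₁ x = Fin.splitAt⁻¹-↑ˡ eq
  ... | inj₂ y = trans (cong (f zero ↑ʳ_) (enc-dec (f ∘ suc) y)) (Fin.splitAt⁻¹-↑ʳ eq)

  enc-monoˡ : ∀ (f : Fin k → ℕ) {i j} x y → i < j → enc f i x < enc f j y
  enc-monoˡ {suc k} f {zero} {suc j} x y _ = subst₂ ℕ._<_
    (sym (Fin.toℕ-↑ˡ x _)) (sym (Fin.toℕ-↑ʳ (f zero) (enc (f ∘ suc) j y)))
    (<-≤-trans (Fin.toℕ<n x) (m≤m+n (f zero) _))
  enc-monoˡ {suc k} f {suc i} {suc j} x y (s≤s i<j) = subst₂ ℕ._<_
    (sym (Fin.toℕ-↑ʳ (f zero) _)) (sym (Fin.toℕ-↑ʳ (f zero) _))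
    (+-monoʳ-< (f zero) (enc-monoˡ (f ∘ suc) x y i<j))

  enc-monoʳ : ∀ (f : Fin k → ℕ) i {x y} → x < y → enc f i x < enc f i y
  enc-monoʳ {suc k} f zero {x} {y} x<y = subst₂ ℕ._<_
    (sym (Fin.toℕ-↑ˡ x _)) (sym (Fin.toℕ-↑ˡ y _)) x<y
  enc-monoʳ {suc k} f (suc i) x<y = subst₂ ℕ._<_
    (sym (Fin.toℕ-↑ʳ (f zero) _)) (sym (Fin.toℕ-↑ʳ (f zero) _))
    (+-monoʳ-< (f zero) (enc-monoʳ (f ∘ suc) i x<y))

  ∑-+ : ∀ a {b} (g : Fin (a + b) → ℕ) → sum g ≡ ∑[ i < a ] g (i ↑ˡ b) + ∑[ j < b ] g (a ↑ʳ j)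
  ∑-+ zero    g = refl
  ∑-+ (suc a) g = trans (cong (g zero +_) (∑-+ a (g ∘ suc))) (sym (+-assoc (g zero) _ _))

  ∑-enc : ∀ (f : Fin k → ℕ) (g : Fin (sum f) → ℕ) →
          sum g ≡ ∑[ i < k ] ∑[ x < f i ] g (enc f i x)
  ∑-enc {zero}  f g = refl
  ∑-enc {suc k} f g = trans (∑-+ (f zero) g)
    (cong (∑[ x < f zero ] g (x ↑ˡ _) +_) (∑-enc (f ∘ suc) (g ∘ (f zero ↑ʳ_))))

  δ-sym : ∀ (i j : Fin r) → δ i j ≡ δ j i
  δ-sym zero    zero    = refl
  δ-sym zero    (suc j) = refl
  δ-sym (suc i) zero    = refl
  δ-sym (suc i) (suc j) = δ-sym i j

  module FromMatrix (A : Fin r → Fin r → ℕ) (A-sym : ∀ i j → A i j ≡ A j i) where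

    rowSum : Fin r → ℕ
    rowSum i = ∑[ j < r ] A i j

    N : ℕ
    N = ∑[ i < r ] rowSum i

    Unit : Set
    Unit = Σ[ i ∈ Fin r ] Σ[ j ∈ Fin r ] Fin (A i j)

    -- Two levels of blocks, rows and then the cells of a row, number the units lexicographically.
    pos : Unit → Fin N
    pos (i , j , x) = enc rowSum i (enc (A i) j x)

    unit : Fin N → Unit
    unit m = let i , y = dec rowSum m in i , dec (A i) y

    -- A unit keeps its rank x inside its cell, which makes `perm` increasing on each cell.
    flip : Unit → Unit
    flip (i , j , x) = j , i , cast (A-sym i j) x

    unit-pos : ∀ u → unit (pos u) ≡ u
    unit-pos (i , j , x) rewrite dec-enc rowSum i (enc (A i) j x) | dec-enc (A i) j x = refl

    pos-unit : ∀ m → pos (unit m) ≡ m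
    pos-unit m = trans (cong (enc rowSum _) (enc-dec (A (proj₁ (dec rowSum m))) _)) (enc-dec rowSum m)

    flip-flip : ∀ u → flip (flip u) ≡ u
    flip-flip (i , j , x) = cong (λ y → i , j , y) (Fin.cast-involutive (A-sym j i) (A-sym i j) x)

    perm : Fin N → Fin N
    perm = pos ∘ flip ∘ unit

    word : Fin N → Fin r
    word = proj₁ ∘ unit

    perm-involutive : Involutive _≡_ perm
    perm-involutive m = begin
      pos (flip (unit (pos (flip (unit m))))) ≡⟨ cong (pos ∘ flip) (unit-pos (flip (unit m))) ⟩
      pos (flip (flip (unit m)))              ≡⟨ cong pos (flip-flip (unit m)) ⟩
      pos (unit m)                            ≡⟨ pos-unit m ⟩
      m                                       ∎
      where open ≡-Reasoning

    private
      -- Within one row i, the flipped units lie in the rows j and j′. If j < j′ this decides their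
      -- order; if j and j′ agree, both stay in one cell and keep their ranks.
      lex : ∀ u v → pos u < pos v →
            proj₁ u < proj₁ v ⊎ (proj₁ u ≡ proj₁ v × pos (flip u) < pos (flip v))
      lex (i , j , x) (i′ , j′ , x′) u<v with Fin.<-cmp i i′
      ... | tri< i<i′ _ _ = inj₁ i<i′
      ... | tri> _ _ i′<i = ⊥-elim (Fin.<-asym u<v (enc-monoˡ _ _ _ i′<i))
      ... | tri≈ _ refl _ with Fin.<-cmp j j′
      ...   | tri< j<j′ _ _ = inj₂ (refl , enc-monoˡ _ _ _ j<j′)
      ...   | tri> _ _ j′<j = ⊥-elim (Fin.<-asym u<v (enc-monoʳ _ i (enc-monoˡ (A i) x′ x j′<j)))
      ...   | tri≈ _ refl _ with Fin.<-cmp x x′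
      ...     | tri< x<x′ _ _ = inj₂ (refl , enc-monoʳ _ j (enc-monoʳ (A j) i
                  (subst₂ ℕ._<_ (sym (Fin.toℕ-cast _ x)) (sym (Fin.toℕ-cast _ x′)) x<x′)))
      ...     | tri> _ _ x′<x = ⊥-elim (Fin.<-asym u<v (enc-monoʳ _ i (enc-monoʳ (A i) j x′<x)))
      ...     | tri≈ _ refl _ = ⊥-elim (Fin.<-irrefl refl u<v)

    compatible : Compatible perm word
    compatible m m′ m<m′ =
      lex (unit m) (unit m′) (subst₂ _<_ (sym (pos-unit m)) (sym (pos-unit m′)) m<m′)

    -- Summed over units, the cell (i′ , j′) contributes A i′ j′ equal terms, and the indicators
    -- single out the cell (i , j).
    count≡A : ∀ i j → count perm word i j ≡ A i j
    count≡A i j = begin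
      ∑[ m < N ] (δ (word m) i * δ (word (perm m)) j)
        ≡⟨ sum-cong-≗ {N} (λ m →
             cong (λ u → δ (word m) i * δ (proj₁ u) j) (unit-pos (flip (unit m)))) ⟩
      ∑[ m < N ] g (unit m)
        ≡⟨ ∑-enc rowSum (g ∘ unit) ⟩
      ∑[ i′ < r ] ∑[ y < rowSum i′ ] g (unit (enc rowSum i′ y))
        ≡⟨ sum-cong-≗ (λ i′ → ∑-enc (A i′) _) ⟩
      ∑[ i′ < r ] ∑[ j′ < r ] ∑[ x < A i′ j′ ] g (unit (pos (i′ , j′ , x)))
        ≡⟨ sum-cong-≗ (λ i′ → sum-cong-≗ λ j′ → trans
             (sum-cong-≗ λ x → cong g (unit-pos (i′ , j′ , x)))
             (trans (∑-const (A i′ j′) _) (*-comm (A i′ j′) _))) ⟩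
      ∑[ i′ < r ] ∑[ j′ < r ] (δ i′ i * δ j′ j * A i′ j′)
        ≡⟨ sum-cong-≗ {r} (λ i′ → trans
             (sum-cong-≗ {r} λ j′ → *-assoc (δ i′ i) (δ j′ j) (A i′ j′))
             (sym (*-distribˡ-sum {r} (δ i′ i) _))) ⟩
      ∑[ i′ < r ] (δ i′ i * ∑[ j′ < r ] (δ j′ j * A i′ j′))
        ≡⟨ sum-cong-≗ {r} (λ i′ → cong₂ _*_ (δ-sym i′ i)
             (sum-cong-≗ {r} λ j′ → cong (_* A i′ j′) (δ-sym j′ j))) ⟩
      ∑[ i′ < r ] (δ i i′ * ∑[ j′ < r ] (δ j j′ * A i′ j′))
        ≡⟨ ∑-δ i _ ⟩
      ∑[ j′ < r ] (δ j j′ * A i j′)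
        ≡⟨ ∑-δ j _ ⟩
      A i j ∎
      where
      open ≡-Reasoning
      g : Unit → ℕ
      g (i′ , j′ , _) = δ i′ i * δ j′ j

-- Counting the words compatible with one permutation.

module CompatibleWords where

  open import Data.Bool.Base using (if_then_else_)
  open import Data.Fin.Base using (Fin; zero; suc; toℕ; inject₁; _<_)
  import Data.Fin.Properties as Fin
  open import Data.Integer.Base using (+_; _+_; _-_)
  import Data.Integer.Properties as ℤ
  open import Data.Integer.Tactic.RingSolver using (solve-∀)
  open import Data.Nat.Base as ℕ using (ℕ; zero; suc; z≤n; s≤s; _≤_)
  import Data.Nat.Properties as ℕ
  open import Relation.Binary.Core using (Rel)
  open Differences
  open Correspondence using (Lex; Compatible)

  private variable
    m n r : ℕ

  raise : Vec (Fin r) m → Vec (Fin (suc r)) m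
  raise = Vec.map suc

  raise-injective : {v w : Vec (Fin r) m} → raise v ≡ raise w → v ≡ w
  raise-injective {v = []}    {[]}    _  = refl
  raise-injective {v = x ∷ v} {y ∷ w} eq =
    cong₂ _∷_ (Fin.suc-injective (cong Vec.head eq)) (raise-injective (cong Vec.tail eq))

  -- The words w with D₀ ≤ w₀ and Dᵢ₊₁ + wᵢ ≤ wᵢ₊₁.
  chains : Vec ℕ m → ∀ r → List (Vec (Fin r) m)
  chains []          r       = [] ∷ []
  chains (g ∷ D)     zero    = []
  chains (zero ∷ D)  (suc r) =
    List.map (zero ∷_) (chains D (suc r)) ++ List.map raise (chains (zero ∷ D) r)
  chains (suc g ∷ D) (suc r) = List.map raise (chains (g ∷ D) r)

  -- `p` is the preceding letter; starting from 0 makes the first gap a lower bound on the first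
  -- letter.
  Chain : ℕ → Vec ℕ m → Vec (Fin r) m → Set
  Chain p []      []      = ⊤
  Chain p (g ∷ D) (x ∷ w) = g ℕ.+ p ≤ toℕ x × Chain (toℕ x) D w

  Chain-raise : ∀ {p} (D : Vec ℕ m) (w : Vec (Fin r) m) → Chain p D w → Chain (suc p) D (raise w)
  Chain-raise []      []      _         = tt
  Chain-raise {p = p} (g ∷ D) (x ∷ w) (le , c) =
    subst (_≤ suc (toℕ x)) (sym (ℕ.+-suc g p)) (s≤s le) , Chain-raise D w c

  -- Under a positive lower bound no letter is zero, so all of them can be lowered by one.
  Chain-lower : ∀ {p} (D : Vec ℕ m) (w : Vec (Fin (suc r)) m) → Chain (suc p) D w →
                ∃ λ v → raise v ≡ w × Chain p D v
  Chain-lower []      []      _ = [] , refl , tt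
  Chain-lower {p = p} (g ∷ D) (x ∷ w) (le , c) with x | subst (_≤ toℕ x) (ℕ.+-suc g p) le
  ... | suc x′ | s≤s le′ =
    let v , eq , c′ = Chain-lower D w c in x′ ∷ v , cong (suc x′ ∷_) eq , le′ , c′

  chains-sound : ∀ (D : Vec ℕ m) r {w} → w ∈ chains D r → Chain 0 D w
  chains-sound [] r (here refl) = tt
  chains-sound (zero ∷ D) (suc r) p with ∈-++⁻ (List.map (zero ∷_) (chains D (suc r))) p
  ... | inj₁ q with _ , w∈ , refl ← ∈-map⁻ (zero ∷_) q = z≤n , chains-sound D (suc r) w∈
  ... | inj₂ q with x ∷ w , w∈ , refl ← ∈-map⁻ raise q =
    z≤n , Chain-raise D w (proj₂ (chains-sound (zero ∷ D) r w∈))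
  chains-sound (suc g ∷ D) (suc r) p with x ∷ w , w∈ , refl ← ∈-map⁻ raise p =
    let le , c = chains-sound (g ∷ D) r w∈ in s≤s le , Chain-raise D w c

  chains-complete : ∀ (D : Vec ℕ m) r w → Chain 0 D w → w ∈ chains D r
  chains-complete []          r       []            _        = here refl
  chains-complete (zero ∷ D)  (suc r) (zero ∷ w)    (_ , c)  =
    ∈-++⁺ˡ (∈-map⁺ (zero ∷_) (chains-complete D (suc r) w c))
  chains-complete (zero ∷ D)  (suc r) (suc x ∷ w)   (_ , c)
    with v , refl , c′ ← Chain-lower D w c =
    ∈-++⁺ʳ (List.map (zero ∷_) (chains D (suc r)))
      (∈-map⁺ raise (chains-complete (zero ∷ D) r (x ∷ v) (z≤n , c′)))
  chains-complete (suc g ∷ D) (suc r) (suc x ∷ w) (s≤s le , c)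
    with v , refl , c′ ← Chain-lower D w c =
    ∈-map⁺ raise (chains-complete (g ∷ D) r (x ∷ v) (le , c′))

  chains-unique : ∀ (D : Vec ℕ m) r → Unique (chains D r)
  chains-unique []          r       = [] ∷ []
  chains-unique (g ∷ D)     zero    = []
  chains-unique (zero ∷ D)  (suc r) = Unique.++⁺
    (Unique.map⁺ ∷-injectiveʳ (chains-unique D (suc r)))
    (Unique.map⁺ raise-injective (chains-unique (zero ∷ D) r)) disjoint
    where
    disjoint : ∀ {w} → w ∈ List.map (zero ∷_) (chains D (suc r)) ×
                       w ∈ List.map raise (chains (zero ∷ D) r) → _
    disjoint (p , q) with ∈-map⁻ (zero ∷_) p | ∈-map⁻ raise q
    ... | _ , _ , refl | _ ∷ _ , _ , ()
  chains-unique (suc g ∷ D) (suc r) = Unique.map⁺ raise-injective (chains-unique (g ∷ D) r)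

  -- The coefficients of t^d.
  point : ℕ → Seq
  point zero    zero    = + 1
  point zero    (suc k) = + 0
  point (suc d) k       = shift (point d) k

  #chains : Vec ℕ m → Seq
  #chains D s = + length (chains D (suc s))

  -- The words that do not start with 0 are the raised words over one letter fewer. The difference
  -- removes them, and dropping the initial 0 leaves a word for D.
  ∇-#chains : ∀ (D : Vec ℕ m) → ∇ (#chains (zero ∷ D)) ≗ #chains D
  ∇-#chains D zero    = trans (ℤ.+-identityʳ _) (cong +_ (trans
    (length-++ (List.map (zero ∷_) (chains D 1)))
    (trans (ℕ.+-identityʳ _) (length-map (zero ∷_) (chains D 1)))))
  ∇-#chains D (suc s) = begin
    + length (List.map (zero ∷_) (chains D (2 ℕ.+ s)) ++ List.map raise (chains (zero ∷ D) (1 ℕ.+ s)))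
      - #chains (zero ∷ D) s
      ≡⟨ cong (λ x → + x - #chains (zero ∷ D) s) (trans
           (length-++ (List.map (zero ∷_) (chains D (2 ℕ.+ s))))
           (cong₂ ℕ._+_ (length-map (zero ∷_) (chains D (2 ℕ.+ s)))
                        (length-map raise (chains (zero ∷ D) (1 ℕ.+ s))))) ⟩
    #chains D (suc s) + #chains (zero ∷ D) s - #chains (zero ∷ D) s
      ≡⟨ lem (#chains D (suc s)) (#chains (zero ∷ D) s) ⟩
    #chains D (suc s) ∎
    where
    open ≡-Reasoning
    lem : ∀ a b → a + b - b ≡ a
    lem = solve-∀

  #chains-suc : ∀ g (D : Vec ℕ m) → #chains (suc g ∷ D) ≗ shift (#chains (g ∷ D))
  #chains-suc g D zero    = refl
  #chains-suc g D (suc s) = cong +_ (length-map raise (chains (g ∷ D) (suc s)))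

  -- The generating function in s is t^(`Vec.sum D`) / (1 - t)^(m + 1): each unit of a gap gives a
  -- factor t, each position a factor 1/(1 - t), and the empty word, counted once for every s, the
  -- last 1/(1 - t).
  ∇^-#chains : ∀ (D : Vec ℕ m) → ∇^ (suc m) (#chains D) ≗ point (Vec.sum D)
  ∇^-#chains []          zero    = refl
  ∇^-#chains []          (suc k) = refl
  ∇^-#chains {suc m} (zero ∷ D)  k = begin
    ∇ (∇^ (suc m) (#chains (zero ∷ D))) k ≡⟨ ∇^-∇ (suc m) (#chains (zero ∷ D)) k ⟨
    ∇^ (suc m) (∇ (#chains (zero ∷ D))) k ≡⟨ ∇^-cong (suc m) (∇-#chains D) k ⟩
    ∇^ (suc m) (#chains D) k              ≡⟨ ∇^-#chains D k ⟩
    point (Vec.sum D) k                   ∎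
    where open ≡-Reasoning
  ∇^-#chains {suc m} (suc g ∷ D) k = begin
    ∇^ (2 ℕ.+ m) (#chains (suc g ∷ D)) k     ≡⟨ ∇^-cong (2 ℕ.+ m) (#chains-suc g D) k ⟩
    ∇^ (2 ℕ.+ m) (shift (#chains (g ∷ D))) k ≡⟨ ∇^-shift (2 ℕ.+ m) (#chains (g ∷ D)) k ⟩
    shift (∇^ (2 ℕ.+ m) (#chains (g ∷ D))) k ≡⟨ shift-cong (∇^-#chains (g ∷ D)) k ⟩
    shift (point (Vec.sum (g ∷ D))) k        ∎
    where open ≡-Reasoning

  gap : Word (suc m) → Fin m → ℕ
  gap π i = if does (isDescent? π i) then 1 else 0

  gap-descent : ∀ (π : Word (suc m)) {i} → IsDescent π i → gap π i ≡ 1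
  gap-descent π {i} p = cong (λ b → if b then 1 else 0) (dec-true (isDescent? π i) p)

  gap-ascent : ∀ (π : Word (suc m)) {i} → ¬ IsDescent π i → gap π i ≡ 0
  gap-ascent π {i} ¬p = cong (λ b → if b then 1 else 0) (dec-false (isDescent? π i) ¬p)

  -- The leading 0 leaves the first letter free and adds nothing to the sum, which is to be `d π`.
  gaps : Word m → Vec ℕ m
  gaps {zero}  π = []
  gaps {suc m} π = 0 ∷ tabulate (gap π)

  length-filter-tabulate : ∀ {A : Set} {P : A → Set} (P? : Decidable P) (f : Fin m → A) →
    length (filter P? (List.tabulate f)) ≡
    Vec.sum (tabulate (λ i → if does (P? (f i)) then 1 else 0))
  length-filter-tabulate {zero}  P? f = refl
  length-filter-tabulate {suc m} P? f with P? (f zero)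
  ... | yes _ = cong suc (length-filter-tabulate P? (f ∘ suc))
  ... | no  _ = length-filter-tabulate P? (f ∘ suc)

  d≡sum-gaps : (π : Word m) → d π ≡ Vec.sum (gaps π)
  d≡sum-gaps {zero}  π = refl
  d≡sum-gaps {suc m} π = length-filter-tabulate (isDescent? π) (λ i → i)

  Chain⇒steps : ∀ {p} (D : Vec ℕ (suc m)) (w : Vec (Fin r) (suc m)) → Chain p D w →
                ∀ i → lookup D (suc i) ℕ.+ toℕ (lookup w (inject₁ i)) ≤ toℕ (lookup w (suc i))
  Chain⇒steps (g ∷ g′ ∷ D) (x ∷ y ∷ w) (_ , le , c) zero    = le
  Chain⇒steps (g ∷ g′ ∷ D) (x ∷ y ∷ w) (_ , c)      (suc i) = Chain⇒steps (g′ ∷ D) (y ∷ w) c i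

  steps⇒Chain : ∀ {p} (D : Vec ℕ (suc m)) (w : Vec (Fin r) (suc m)) →
                lookup D zero ℕ.+ p ≤ toℕ (lookup w zero) →
                (∀ i → lookup D (suc i) ℕ.+ toℕ (lookup w (inject₁ i)) ≤ toℕ (lookup w (suc i))) →
                Chain p D w
  steps⇒Chain (g ∷ [])     (x ∷ [])    start steps = start , tt
  steps⇒Chain (g ∷ g′ ∷ D) (x ∷ y ∷ w) start steps =
    start , steps⇒Chain (g′ ∷ D) (y ∷ w) (steps zero) (steps ∘ suc)

  -- This carries the condition on neighbours, where descents live, to the distant pairs of
  -- `Compatible`.
  from-steps : ∀ {T : Rel (Fin (suc m)) 0ℓ} → Transitive T → (∀ i → T (inject₁ i) (suc i)) →
               ∀ i j → i < j → T i j
  from-steps {suc m} T-trans step zero    (suc zero)    _ = step zero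
  from-steps {suc m} {T} T-trans step zero    (suc (suc j)) _ =
    T-trans (step zero) (from-steps {T = T on suc} T-trans (step ∘ suc) zero (suc j) (s≤s z≤n))
  from-steps {suc m} {T} T-trans step (suc i) (suc j) (s≤s i<j) =
    from-steps {T = T on suc} T-trans (step ∘ suc) i j i<j

  Lex-trans : ∀ (π : Word n) (w : Fin n → Fin r) → Transitive (Lex π w)
  Lex-trans π w (inj₁ lt)        (inj₁ lt′)         = inj₁ (Fin.<-trans lt lt′)
  Lex-trans π w {i} (inj₁ lt)    (inj₂ (eq , _))    = inj₁ (subst (w i <_) eq lt)
  Lex-trans π w {k = k} (inj₂ (eq , _)) (inj₁ lt)   = inj₁ (subst (_< w k) (sym eq) lt)
  Lex-trans π w (inj₂ (eq , lt)) (inj₂ (eq′ , lt′)) = inj₂ (trans eq eq′ , Fin.<-trans lt lt′)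

  -- Since `Lex` is transitive, neighbours suffice. At a descent the gap 1 forces a strict rise of
  -- w; elsewhere w may tie, and then the weak ascent of π is strict by injectivity.
  Chain⇒Compatible : ∀ {π : Word n} → Injective _≡_ _≡_ π → (w : Vec (Fin r) n) →
                     Chain 0 (gaps π) w → Compatible π (lookup w)
  Chain⇒Compatible {suc n} {π = π} π-inj w c = from-steps (Lex-trans π (lookup w)) step
    where
    gap-step : ∀ i → gap π i ℕ.+ toℕ (lookup w (inject₁ i)) ≤ toℕ (lookup w (suc i))
    gap-step i = subst (λ g → g ℕ.+ _ ≤ _) (lookup∘tabulate (gap π) i) (Chain⇒steps (gaps π) w c i)
    step : ∀ i → Lex π (lookup w) (inject₁ i) (suc i)
    step i with isDescent? π i
    ... | yes descent = inj₁ (subst (λ g → g ℕ.+ _ ≤ _) (gap-descent π descent) (gap-step i))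
    ... | no ¬descent with subst (λ g → g ℕ.+ _ ≤ _) (gap-ascent π ¬descent) (gap-step i)
                         | lookup w (inject₁ i) Fin.≟ lookup w (suc i)
    ...   | le | no  ≢ = inj₁ (Fin.≤∧≢⇒< le ≢)
    ...   | _  | yes ≡ = inj₂ (≡ , Fin.≤∧≢⇒< (ℕ.≮⇒≥ ¬descent) λ eq →
            ⊥-elim (Fin.<-irrefl (π-inj eq) (s≤s (ℕ.≤-reflexive (Fin.toℕ-inject₁ i)))))

  -- A descent excludes the second alternative of `Lex`, so the letter rises strictly there.
  Compatible⇒Chain : ∀ (π : Word n) (w : Vec (Fin r) n) → Compatible π (lookup w) →
                     Chain 0 (gaps π) w
  Compatible⇒Chain {zero}  π []  compat = tt
  Compatible⇒Chain {suc n} π w   compat = steps⇒Chain (gaps π) w z≤n λ i →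
      subst (λ g → g ℕ.+ _ ≤ _) (sym (lookup∘tabulate (gap π) i)) (gap-step i)
    where
    gap-step : ∀ i → gap π i ℕ.+ toℕ (lookup w (inject₁ i)) ≤ toℕ (lookup w (suc i))
    gap-step i with isDescent? π i | compat (inject₁ i) (suc i) (s≤s (ℕ.≤-reflexive (Fin.toℕ-inject₁ i)))
    ... | yes descent | inj₁ lt       rewrite gap-descent π descent = lt
    ... | yes descent | inj₂ (_ , lt) = ⊥-elim (Fin.<-asym descent lt)
    ... | no ¬descent | inj₁ lt       rewrite gap-ascent π ¬descent = ℕ.<⇒≤ lt
    ... | no ¬descent | inj₂ (eq , _) rewrite gap-ascent π ¬descent = ℕ.≤-reflexive (cong toℕ eq)

-- Counting compatible pairs, and the recurrence for `I`.

open Differences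
open LogarithmicDerivative using (Rec)
open SymmetricMatrices
open Correspondence
open CompatibleWords
open import Data.Bool.Base using (true; false)
open import Data.Fin.Base using (Fin; zero; suc; combine; finToFun; funToFin)
import Data.Fin.Properties as Fin
open import Data.Integer.Base using (ℤ; +_; -[1+_]; _+_; _-_; _*_; _^_)
import Data.Integer.Properties as ℤ
open import Data.Integer.Tactic.RingSolver using (solve-∀)
open import Data.Nat.Base as ℕ using (ℕ; zero; suc; _∸_; _≥_; s≤s)
import Data.Nat.Properties as ℕ
open import Algebra.Properties.Semiring.Sum ℕ.+-*-semiring using (sum-cong-≗)

private variable
  n r : ℕ

involutive⇒injective : {π : Word n} → Involutive _≡_ π → Injective _≡_ _≡_ π
involutive⇒injective {π = π} inv {i} {j} eq = trans (sym (inv i)) (trans (cong π eq) (inv j))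

involutive⇒IsInvolution : {π : Word n} → Involutive _≡_ π → IsInvolution π
involutive⇒IsInvolution {π = π} inv =
  (involutive⇒injective inv , λ j → π j , λ where refl → inv j) , inv

wordAt : ∀ n → Fin (n ℕ.^ n) → Word n
wordAt n = finToFun

wordAt-injective : ∀ {j j′} → wordAt n j ≗ wordAt n j′ → j ≡ j′
wordAt-injective {n} {j} {j′} eq = begin
  j                     ≡⟨ Fin.funToFin-finToFin {n} {n} j ⟨
  funToFin (wordAt n j) ≡⟨ funToFin-cong eq ⟩
  funToFin (wordAt n j′) ≡⟨ Fin.funToFin-finToFin {n} {n} j′ ⟩
  j′                    ∎
  where
  open ≡-Reasoning
  funToFin-cong : ∀ {m n} {f g : Fin m → Fin n} → f ≗ g → funToFin f ≡ funToFin g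
  funToFin-cong {zero}  eq = refl
  funToFin-cong {suc m} eq = cong₂ combine (eq zero) (funToFin-cong (eq ∘ suc))

Compatible-resp : ∀ {π π′ : Word n} {w w′ : Fin n → Fin r} → π ≗ π′ → w ≗ w′ →
                  Compatible π w → Compatible π′ w′
Compatible-resp π≗ w≗ compat i j i<j rewrite sym (π≗ i) | sym (π≗ j) | sym (w≗ i) | sym (w≗ j) =
  compat i j i<j

count-cong : ∀ {π π′ : Word n} {w w′ : Fin n → Fin r} → π ≗ π′ → w ≗ w′ →
             ∀ i j → count π w i j ≡ count π′ w′ i j
count-cong {w′ = w′} π≗ w≗ i j = sum-cong-≗ λ m →
  cong₂ (λ a b → δ a i ℕ.* δ b j) (w≗ m) (trans (w≗ _) (cong w′ (π≗ m)))

-- Indices stand for the involutions because pointwise equal words have equal indices, as the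
-- counting of lists up to `_≡_` requires.
involutions : ∀ n → List (Fin (n ℕ.^ n))
involutions n = filter (isInvolution? ∘ wordAt n) (allFin (n ℕ.^ n))

compatibleWords : ∀ n r → Fin (n ℕ.^ n) → List (Vec (Fin r) n)
compatibleWords n r j = chains (gaps (wordAt n j)) r

compatiblePairs : ∀ n r → List (Fin (n ℕ.^ n) × Vec (Fin r) n)
compatiblePairs n r = pairs (compatibleWords n r) (involutions n)

toSym : Fin (n ℕ.^ n) × Vec (Fin r) n → Sym r
toSym {n} (j , w) = fromEntries (count (wordAt n j) (lookup w))

compatiblePairs⁻ : ∀ {j w} → (j , w) ∈ compatiblePairs n r →
                   Involutive _≡_ (wordAt n j) × Compatible (wordAt n j) (lookup w)
compatiblePairs⁻ {n} {r} {j} {w} p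
  with j∈ , w∈ ← ∈-pairs⁻ (compatibleWords n r) (involutions n) p
  with _ , (_ , inv) ← ∈-filter⁻ (isInvolution? ∘ wordAt n) {xs = allFin _} j∈
  = inv , Chain⇒Compatible (involutive⇒injective inv) w (chains-sound _ r w∈)

compatiblePairs⁺ : ∀ {π : Word n} {w : Fin n → Fin r} → Involutive _≡_ π → Compatible π w →
                   (funToFin π , tabulate w) ∈ compatiblePairs n r
compatiblePairs⁺ {n} {r} {π} {w} inv compat = ∈-pairs⁺ (compatibleWords n r)
    (∈-filter⁺ (isInvolution? ∘ wordAt n) (∈-allFin _) (involutive⇒IsInvolution inv′))
    (chains-complete _ r _ (Compatible⇒Chain _ _
      (Compatible-resp π≗ (λ i → sym (lookup∘tabulate w i)) compat)))
  where
  π≗ : π ≗ wordAt n (funToFin π)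
  π≗ i = sym (Fin.finToFun-funToFin π i)
  inv′ : Involutive _≡_ (wordAt n (funToFin π))
  inv′ i = trans (sym (trans (cong π (π≗ i)) (π≗ _))) (inv i)

-- The values of `toSym` have total n by `total-count`, `word-unique` and `perm-unique` make it
-- injective, and `FromMatrix` provides preimages.
length-compatiblePairs : ∀ n r → length (compatiblePairs n r) ≡ length (syms r n)
length-compatiblePairs n r = length-≡ toSym
    (pairs! (compatibleWords n r) (Unique.filter⁺ (isInvolution? ∘ wordAt n) (Unique.allFin⁺ _))
      (λ j → chains-unique (gaps (wordAt n j)) r))
    (E .unique n) into injective surjective
  where
  open Enumerates
  E = syms-enumerates r
  into : ∀ {p} → p ∈ compatiblePairs n r → toSym p ∈ syms r n
  into {j , w} p = subst (λ s → toSym (j , w) ∈ syms r s) total≡n (E .complete (toSym (j , w)))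
    where
    π = wordAt n j
    inv = proj₁ (compatiblePairs⁻ p)
    total≡n : weight r (toSym (j , w)) ≡ n
    total≡n = trans (weight≡total r (toSym (j , w))) (trans
      (sum-cong-≗ λ i → sum-cong-≗ λ i′ →
        entry-fromEntries (count π (lookup w)) (count-sym (lookup w) inv) i i′)
      (total-count π (lookup w)))
  injective : ∀ {p q} → p ∈ compatiblePairs n r → q ∈ compatiblePairs n r →
              toSym p ≡ toSym q → p ≡ q
  injective {j , w} {j′ , w′} p∈ q∈ eq
    with inv , compat ← compatiblePairs⁻ p∈ | inv′ , compat′ ← compatiblePairs⁻ q∈ =
    cong₂ _,_ (wordAt-injective (perm-unique inv inv′ compat compat′ same))
      (trans (sym (tabulate∘lookup w)) (trans
        (tabulate-cong (word-unique inv inv′ compat compat′ same)) (tabulate∘lookup w′)))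
    where
    same : ∀ i i′ → count (wordAt n j) (lookup w) i i′ ≡ count (wordAt n j′) (lookup w′) i i′
    same i i′ = begin
      count (wordAt n j) (lookup w) i i′
        ≡⟨ entry-fromEntries _ (count-sym (lookup w) (proj₁ (compatiblePairs⁻ p∈))) i i′ ⟨
      entry (toSym (j , w)) i i′
        ≡⟨ cong (λ a → entry a i i′) eq ⟩
      entry (toSym (j′ , w′)) i i′
        ≡⟨ entry-fromEntries _ (count-sym (lookup w′) (proj₁ (compatiblePairs⁻ q∈))) i i′ ⟩
      count (wordAt n j′) (lookup w′) i i′ ∎
      where open ≡-Reasoning
  surjective : ∀ {a} → a ∈ syms r n → ∃ λ p → p ∈ compatiblePairs n r × toSym p ≡ a
  surjective {a} a∈ with trans (sym (E .sound n a∈)) (weight≡total r a)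
  -- The matched equality replaces n by the total of a, the length on which `perm` and `word` are
  -- defined.
  ... | refl = (funToFin perm , tabulate word) , compatiblePairs⁺ perm-involutive compatible ,
      fromEntries-entry a λ i j → trans
        (count-cong (Fin.finToFun-funToFin perm) (lookup∘tabulate word) i j) (count≡A i j)
    where open FromMatrix (entry a) (entry-sym a)

#compatiblePairs : ℕ → Seq
#compatiblePairs n s = + length (compatiblePairs n (suc s))

-- With r = s + 1, the factor r² is split in two so that each factor s + 1 is one application of
-- `mul`.
Rec-ℤ : ∀ {s q c} → Rec (suc s) q c → suc s ℕ.+ 2 ℕ.* q ≡ suc s ℕ.* suc s →
        ∀ n → + (2 ℕ.+ n) * + c (2 ℕ.+ n) ≡
              (+ s + + 1) * + c (1 ℕ.+ n) + ((+ s + + 1) * ((+ s + + 1) * + c n) + + n * + c n)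
Rec-ℤ {s} {q} {c} R p+2q≡p² n = begin
  + (2 ℕ.+ n) * + c (2 ℕ.+ n)
    ≡⟨ ℤ.pos-* (2 ℕ.+ n) (c (2 ℕ.+ n)) ⟨
  + ((2 ℕ.+ n) ℕ.* c (2 ℕ.+ n))
    ≡⟨ cong +_ (trans (R .Rec.rec₂ n)
         (cong (λ x → p ℕ.* c (suc n) ℕ.+ (x ℕ.+ n) ℕ.* c n) p+2q≡p²)) ⟩
  + (p ℕ.* c (suc n) ℕ.+ (p ℕ.* p ℕ.+ n) ℕ.* c n)
    ≡⟨ cong₂ _+_ (ℤ.pos-* p (c (suc n)))
         (trans (ℤ.pos-* (p ℕ.* p ℕ.+ n) (c n))
                (cong (λ x → (x + + n) * + c n) (ℤ.pos-* p p))) ⟩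
  + p * + c (suc n) + (+ p * + p + + n) * + c n
    ≡⟨ lem (+ s) (+ n) (+ c (suc n)) (+ c n) ⟩
  (+ s + + 1) * + c (suc n) + ((+ s + + 1) * ((+ s + + 1) * + c n) + + n * + c n) ∎
  where
  open ≡-Reasoning
  p = suc s
  lem : ∀ s n a b → (+ 1 + s) * a + ((+ 1 + s) * (+ 1 + s) + n) * b
                  ≡ (s + + 1) * a + ((s + + 1) * ((s + + 1) * b) + n * b)
  lem = solve-∀

#compatiblePairs-rec : ∀ n → + suc (suc n) ⊙ #compatiblePairs (suc (suc n)) ≗
  mul (#compatiblePairs (suc n)) ⊕
  (mul (mul (#compatiblePairs n)) ⊕ (+ n ⊙ #compatiblePairs n))
#compatiblePairs-rec n s = begin
  + suc (suc n) * #compatiblePairs (suc (suc n)) s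
    ≡⟨ cong (+ suc (suc n) *_) (#syms (suc (suc n))) ⟩
  + suc (suc n) * + length (syms (suc s) (suc (suc n)))
    ≡⟨ Rec-ℤ (syms-Rec (suc s)) (r+2*triangle (suc s)) n ⟩
  f (+ length (syms (suc s) (suc n))) (+ length (syms (suc s) n))
    ≡⟨ cong₂ f (#syms (suc n)) (#syms n) ⟨
  f (#compatiblePairs (suc n) s) (#compatiblePairs n s) ∎
  where
  open ≡-Reasoning
  #syms : ∀ m → #compatiblePairs m s ≡ + length (syms (suc s) m)
  #syms m = cong +_ (length-compatiblePairs m (suc s))
  f : ℤ → ℤ → ℤ
  f x y = (+ s + + 1) * x + ((+ s + + 1) * ((+ s + + 1) * y) + + n * y)

module _ {A B : Set} (f : A → B) {P Q : B → Set} (P? : Decidable P) (Q? : Decidable Q) where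

  -- This matches the single filter in `I` with the list of involutions filtered again by descents.
  length-filter-×-map : ∀ xs → length (filter (λ y → P? y ×-dec Q? y) (List.map f xs)) ≡
                               length (filter (Q? ∘ f) (filter (P? ∘ f) xs))
  length-filter-×-map [] = refl
  length-filter-×-map (x ∷ xs) with does (P? (f x))
  ... | false = length-filter-×-map xs
  ... | true with does (Q? (f x))
  ...   | false = length-filter-×-map xs
  ...   | true  = cong suc (length-filter-×-map xs)

point-≡ : ∀ d → point d d ≡ + 1
point-≡ zero    = refl
point-≡ (suc d) = point-≡ d

point-≢ : ∀ {d k} → d ≢ k → point d k ≡ + 0
point-≢ {zero}  {zero}  d≢k with () ← d≢k refl
point-≢ {zero}  {suc k} d≢k = refl
point-≢ {suc d} {zero}  d≢k = refl
point-≢ {suc d} {suc k} d≢k = point-≢ (d≢k ∘ cong suc)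

length-pairs-∷ : ∀ {A B : Set} (g : A → List B) x xs →
                 length (pairs g (x ∷ xs)) ≡ length (g x) ℕ.+ length (pairs g xs)
length-pairs-∷ g x xs = trans (length-++ (List.map (x ,_) (g x)))
  (cong (ℕ._+ length (pairs g xs)) (length-map (x ,_) (g x)))

length-filter-∷ : ∀ {A : Set} (e : A → ℕ) k x xs →
  let Q? = λ y → + e y ℤ.≟ + k in
  point (e x) k + + length (filter Q? xs) ≡ + length (filter Q? (x ∷ xs))
length-filter-∷ e k x xs with e x ℕ.≟ k
... | yes refl rewrite point-≡ (e x) | dec-true (+ e x ℤ.≟ + e x) refl = refl
... | no  e≢k  rewrite point-≢ e≢k | dec-false (+ e x ℤ.≟ + k) (e≢k ∘ ℤ.+-injective) =
  ℤ.+-identityˡ _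

-- Differences are additive, so the involutions can be treated one at a time; by `∇^-#chains` each
-- contributes 1 at its number of descents and 0 elsewhere.
∇^-#compatiblePairs : ∀ n → ∇^ (suc n) (#compatiblePairs n) ≗ λ k → I n (+ k)
∇^-#compatiblePairs n k = trans (go (involutions n))
  (cong +_ (sym (length-filter-×-map (wordAt n) isInvolution? (λ π → + d π ℤ.≟ + k) (allFin _))))
  where
  open ≡-Reasoning
  D : Fin (n ℕ.^ n) → Vec ℕ n
  D = gaps ∘ wordAt n
  Q? : Decidable (λ j → + d (wordAt n j) ≡ + k)
  Q? j = + d (wordAt n j) ℤ.≟ + k
  f : List (Fin (n ℕ.^ n)) → Seq
  f js s = + length (pairs (compatibleWords n (suc s)) js)
  go : ∀ js → ∇^ (suc n) (f js) k ≡ + length (filter Q? js)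
  go []       = ∇^-zero (suc n) k
  go (j ∷ js) = begin
    ∇^ (suc n) (f (j ∷ js)) k
      ≡⟨ ∇^-cong (suc n) (λ s → cong +_ (length-pairs-∷ (compatibleWords n (suc s)) j js)) k ⟩
    ∇^ (suc n) (#chains (D j) ⊕ f js) k
      ≡⟨ ∇^-⊕ (suc n) (#chains (D j)) (f js) k ⟩
    ∇^ (suc n) (#chains (D j)) k + ∇^ (suc n) (f js) k
      ≡⟨ cong₂ _+_ (∇^-#chains (D j) k) (go js) ⟩
    point (Vec.sum (D j)) k + + length (filter Q? js)
      ≡⟨ cong (λ e → point e k + + length (filter Q? js)) (d≡sum-gaps (wordAt n j)) ⟨
    point (d (wordAt n j)) k + + length (filter Q? js)
      ≡⟨ length-filter-∷ (λ j → d (wordAt n j)) k j js ⟩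
    + length (filter Q? (j ∷ js)) ∎

I-negative : ∀ m k → I m -[1+ k ] ≡ + 0
I-negative m k = cong +_ (go (words m))
  where
  go : ∀ πs → length (filter (λ π → isInvolution? π ×-dec (+ d π ℤ.≟ -[1+ k ])) πs) ≡ 0
  go []       = refl
  go (π ∷ πs) with does (isInvolution? π)
  ... | true  = go πs
  ... | false = go πs

-- The 0 that `shift` supplies at index 0 is the value of `I` at -1.
I-pred : ∀ m k → I m (+ k - + 1) ≡ shift (λ k → I m (+ k)) k
I-pred m zero    = I-negative m 0
I-pred m (suc k) = refl

I-pred² : ∀ m k → I m (+ k - + 2) ≡ shift (shift (λ k → I m (+ k))) k
I-pred² m zero          = I-negative m 1
I-pred² m (suc zero)    = I-negative m 0
I-pred² m (suc (suc k)) = refl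

theorem2p2 : (n k : ℕ) → n ≥ 3 →
    + n * I n (+ k) ≡
    (+ k + + 1) * I (n ∸ 1) (+ k)
    + (+ n - + k) * I (n ∸ 1) (+ k - + 1)
    + ((+ k + + 1) ^ 2 + + n - + 2) * I (n ∸ 2) (+ k)
    + (+ 2 * + k * (+ n - + k - + 1) - + n + + 3) * I (n ∸ 2) (+ k - + 1)
    + ((+ n - + k) ^ 2 + + n - + 2) * I (n ∸ 2) (+ k - + 2)
theorem2p2 (suc (suc n)) k (s≤s (s≤s _)) = begin
  + suc (suc n) * I (suc (suc n)) (+ k)
    -- F, G and H count compatible pairs of lengths n + 2, n + 1 and n; their differences f, g and h
    -- count involutions by descents.
    ≡⟨ coefficients-rec
         (#compatiblePairs (suc (suc n))) (#compatiblePairs (suc n)) (#compatiblePairs n)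
         (λ k → I (suc (suc n)) (+ k)) (λ k → I (suc n) (+ k)) (λ k → I n (+ k)) n
         (∇^-#compatiblePairs (suc (suc n))) (∇^-#compatiblePairs (suc n))
         (∇^-#compatiblePairs n) (#compatiblePairs-rec n) k ⟩
  rhs (shift (λ k → I (suc n) (+ k)) k) (shift (λ k → I n (+ k)) k)
      (shift (shift (λ k → I n (+ k))) k)
    ≡⟨ cong₂ (λ x y → rhs x y (shift (shift (λ k → I n (+ k))) k))
         (I-pred (suc n) k) (I-pred n k) ⟨
  rhs (I (suc n) (+ k - + 1)) (I n (+ k - + 1)) (shift (shift (λ k → I n (+ k))) k)
    ≡⟨ cong (rhs (I (suc n) (+ k - + 1)) (I n (+ k - + 1))) (I-pred² n k) ⟨
  rhs (I (suc n) (+ k - + 1)) (I n (+ k - + 1)) (I n (+ k - + 2)) ∎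
  where
  open ≡-Reasoning
  -- The arguments stand for the three terms at k - 1 and k - 2, where `shift` is to be traded for
  -- `I` at a possibly negative index.
  rhs : ℤ → ℤ → ℤ → ℤ
  rhs x y z =
      (+ k + + 1) * I (suc n) (+ k)
    + (+ suc (suc n) - + k) * x
    + ((+ k + + 1) ^ 2 + + suc (suc n) - + 2) * I n (+ k)
    + (+ 2 * + k * (+ suc (suc n) - + k - + 1) - + suc (suc n) + + 3) * y
    + ((+ suc (suc n) - + k) ^ 2 + + suc (suc n) - + 2) * z
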